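{- Let $G$ be a finite graph without isolated vertices and let $q$ be a positive integer. Let $d_v$ denote the degree of vertex $v$ in $G$. Then \[ c_q(G) \le \prod_{uv \in E(G)} c_q(K_{d_u,d_v})^{1/(d_u d_v)}. \]
   Context: Graphs are finite and simple. $c_q(G)$ denotes the number of proper $q$-colorings of $G$, i.e., maps $V(G)\to\{1,\dots,q\}$ such that adjacent vertices receive different colors. $K_{a,b}$ is the complete bipartite graph with parts of sizes $a$ and $b$. The product is over the edges of $G$, each counted once. -}

module Defs where

open import Data.Nat using (ℕ; zero; suc; _+_; _*_; _^_; _<ᵇ_)
open import Data.Bool using (Bool; true; false; T; not; _∧_; _∨_; _xor_; if_then_else_)
open import Data.Fin using (Fin; toℕ; _≟_)
open import Data.List using (List; []; _∷_; map; concatMap; length; filterᵇ; product; allFin)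
open import Data.Product using (_×_; _,_; proj₁; proj₂)
open import Relation.Nullary.Decidable using (⌊_⌋)
open import Relation.Binary.PropositionalEquality using (_≡_)

record Graph (n : ℕ) : Set where
  field
    Adj    : Fin n → Fin n → Bool
    sym    : ∀ i j → Adj i j ≡ Adj j i
    irrefl : ∀ i → Adj i i ≡ false
open Graph public

deg : ∀ {n} → Graph n → Fin n → ℕ
deg {n} G v = length (filterᵇ (Adj G v) (allFin n))

allᵇ : ∀ {A : Set} → (A → Bool) → List A → Bool
allᵇ p []       = true
allᵇ p (x ∷ xs) = p x ∧ allᵇ p xs

extend : ∀ {n q} → Fin q → (Fin n → Fin q) → (Fin (suc n) → Fin q)
extend a f Fin.zero    = a
extend a f (Fin.suc i) = f i

allMaps : (n q : ℕ) → List (Fin n → Fin q)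
allMaps zero    q = (λ ()) ∷ []
allMaps (suc n) q = concatMap (λ a → map (extend a) (allMaps n q)) (allFin q)

isProper : ∀ {n q} → Graph n → (Fin n → Fin q) → Bool
isProper {n} G c =
  allᵇ (λ i → allᵇ (λ j → not (Adj G i j) ∨ not ⌊ c i ≟ c j ⌋) (allFin n)) (allFin n)

colorings : ∀ {n} → ℕ → Graph n → ℕ
colorings {n} q G = length (filterᵇ (isProper G) (allMaps n q))

K : (a b : ℕ) → Graph (a + b)
K a b = record
  { Adj    = λ i j → (toℕ i <ᵇ a) xor (toℕ j <ᵇ a)
  ; sym    = λ i j → xor-comm (toℕ i <ᵇ a) (toℕ j <ᵇ a)
  ; irrefl = λ i → xor-self (toℕ i <ᵇ a)
  }
  where
  xor-comm : ∀ x y → (x xor y) ≡ (y xor x)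
  xor-comm false false = _≡_.refl
  xor-comm false true  = _≡_.refl
  xor-comm true  false = _≡_.refl
  xor-comm true  true  = _≡_.refl
  xor-self : ∀ x → (x xor x) ≡ false
  xor-self false = _≡_.refl
  xor-self true  = _≡_.refl

edges : ∀ {n} → Graph n → List (Fin n × Fin n)
edges {n} G =
  concatMap (λ u → map (λ v → (u , v))
                      (filterᵇ (λ v → (toℕ u <ᵇ toℕ v) ∧ Adj G u v) (allFin n)))
            (allFin n)

-- For a list of pairs (w_e , c_e) put W = ∏_e w_e.
-- powProd returns (W , ∏_e c_e ^ (W / w_e)), computed without division:
--   W / w_e = product of the weights w_f of the other entries f ≠ e.
-- Recurrence: for (w , c) ∷ rest with powProd rest = (W' , R'),
--   W = w * W',  R = c ^ W' * R' ^ w.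
powProd : List (ℕ × ℕ) → ℕ × ℕ
powProd []            = 1 , 1
powProd ((w , c) ∷ r) with powProd r
... | W' , R' = w * W' , (c ^ W') * (R' ^ w)

edgeData : ∀ {n} → ℕ → Graph n → List (ℕ × ℕ)
edgeData q G =
  map (λ e → let du = deg G (proj₁ e) ; dv = deg G (proj₂ e)
             in du * dv , colorings q (K du dv))
      (edges G)

{-# OPTIONS --safe #-}
module Submission where

-- Colour the vertices from lists, with integer weights, and remove a vertex w of maximal degree Δ by summing over its
-- colour x, which disappears from the lists of the neighbours of w.  Write N a b V U for the number of colourings of
-- K_{a,b} with lists V and U.  By induction and Hölder's inequality over x, it suffices to bound, for each edge vu with
-- v ~ w, b = d_v and a = d_u ≤ Δ,
--   ∑_x N a (b-1) (V∖x) U ^ (Δ/a)  ≤  N b Δ W V ^ (1/b) · N a b V U ^ ((b-1)Δ/(ab)),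
-- which is again two applications of Hölder's inequality.  If u ~ w as well, with c = d_u, then both lists lose x, and
--   N (c-1) (b-1) (V∖x) (U∖x) ^ (1/((c-1)(b-1)))  ≤  N c (b-1) (V∖x) U ^ (1/(c(b-1))) · |U∖x| ^ (1/(c-1)) / |U| ^ (1/c)
-- because x does not conflict with any colour of V∖x; this reduces triangles to the previous case.

open import Defs hiding (sym)
open import Data.Nat using (ℕ; zero; suc; pred; _+_; _*_; _^_; _∸_; _≤_; _<_; _≤?_; z≤n; s≤s; _<ᵇ_; _!; >-nonZero)
open import Data.Nat.Properties hiding (_≟_)
open import Data.Nat.DivMod using (_/_; m/n*n≡m)
open import Data.Nat.Divisibility using (∣-trans; m∣m*n; m≤n⇒m!∣n!)
open import Data.Nat.ListAction using (sum; product)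
open import Data.Nat.ListAction.Properties using (sum-++; product-++)
open import Data.Nat.Solver using (module +-*-Solver)
open import Data.Nat.Tactic.RingSolver using (solve-∀)
open import Data.Bool using (Bool; true; false; not; _∧_; _∨_; if_then_else_)
open import Data.Bool.Properties using (∧-comm; ∧-zeroʳ; ∧-identityʳ)
open import Data.Fin using (Fin; zero; suc; toℕ; _≟_)
open import Data.Fin.Properties using (toℕ-injective)
open import Data.List using (List; []; _∷_; _++_; map; concatMap; length; filterᵇ; replicate; allFin)
open import Data.List.Properties using (length-++; length-replicate; map-tabulate)
open import Data.Vec as Vec using (Vec; []; _∷_; lookup)
import Data.Vec.Properties as Vec
open import Data.Product using (∃-syntax; _×_; _,_; proj₁; proj₂)
open import Data.Sum using (_⊎_; inj₁; inj₂)
open import Data.Empty using (⊥-elim)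
open import Function using (_∘_; id)
open import Relation.Nullary using (Dec; yes; no)
open import Relation.Nullary.Decidable using (⌊_⌋)
open import Relation.Binary.PropositionalEquality using (_≡_; _≢_; refl; sym; trans; cong; cong₂; subst; subst₂; module ≡-Reasoning)
open +-*-Solver using (Polynomial; con; _:+_; _:*_; prove; ⟦_⟧; ⟦_⟧↓) renaming (var to expv)

-- Everything happens in ℕ, where neither 1/(d_u d_v) nor Hölder exponents such as Δ/a exist. The
-- claim is therefore proved in the power 2(n!)²: n! is divisible by every degree, and the 2 comes
-- from running over ordered pairs, which lets the two ends of an edge play different roles. Hölder
-- over x has a factor for each edge vu with v ~ w, all with different exponents; `GibbsBound` is a
-- form of it in which factors simply multiply, provided that the exponents add up. They do: each
-- neighbour of w receives the share 1/Δ and splits it equally among its other edges. Maximality of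
-- Δ makes the exponent Δ - a of the local estimate nonnegative. No vertex is deleted: w stays as an
-- isolated vertex whose only colour is x. Neighbours of degree 1 become isolated as well, so the
-- inductive bound needs factors for isolated vertices. The denominators |U| ^ (1/c) from triangles
-- do not depend on x; they are kept on the left and cancelled at the end. That needs nonempty
-- lists, and with an empty list there is no colouring.

infixl 7 _⊗_
infixr 8 _↑_

-- Identities between monomials with variable exponents are reduced to ring identities between the exponents.
data Monomial (k m : ℕ) : Set where
  var : Fin k → Monomial k m
  one : Monomial k m
  _⊗_ : Monomial k m → Monomial k m → Monomial k m
  _↑_ : Monomial k m → Polynomial m → Monomial k m

eval : ∀ {k m} → Vec ℕ k → Vec ℕ m → Monomial k m → ℕ
eval ρ σ (var i) = lookup ρ i
eval ρ σ one     = 1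
eval ρ σ (e ⊗ f) = eval ρ σ e * eval ρ σ f
eval ρ σ (e ↑ n) = eval ρ σ e ^ ⟦ n ⟧ σ

unit : ∀ {k m} → Fin k → Fin k → Polynomial m
unit zero    zero    = con 1
unit zero    (suc j) = con 0
unit (suc i) zero    = con 0
unit (suc i) (suc j) = unit i j

degreeIn : ∀ {k m} → Monomial k m → Fin k → Polynomial m
degreeIn (var i) j = unit i j
degreeIn one     j = con 0
degreeIn (e ⊗ f) j = degreeIn e j :+ degreeIn f j
degreeIn (e ↑ n) j = degreeIn e j :* n

powers : ∀ {k} → Vec ℕ k → (Fin k → ℕ) → ℕ
powers []      d = 1
powers (x ∷ ρ) d = x ^ d zero * powers ρ (d ∘ suc)

powers-cong : ∀ {k} (ρ : Vec ℕ k) {d e : Fin k → ℕ} → (∀ i → d i ≡ e i) → powers ρ d ≡ powers ρ e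
powers-cong []      h = refl
powers-cong (x ∷ ρ) h = cong₂ _*_ (cong (x ^_) (h zero)) (powers-cong ρ (λ i → h (suc i)))

powers-0 : ∀ {k} (ρ : Vec ℕ k) → powers ρ (λ _ → 0) ≡ 1
powers-0 []      = refl
powers-0 (x ∷ ρ) = trans (+-identityʳ _) (powers-0 ρ)

powers-unit : ∀ {k m} (ρ : Vec ℕ k) (σ : Vec ℕ m) i → powers ρ (λ j → ⟦ unit i j ⟧ σ) ≡ lookup ρ i
powers-unit (x ∷ ρ) σ zero    = trans (cong₂ _*_ (^-identityʳ x) (powers-0 ρ)) (*-identityʳ x)
powers-unit (x ∷ ρ) σ (suc i) = trans (+-identityʳ _) (powers-unit ρ σ i)

powers-+ : ∀ {k} (ρ : Vec ℕ k) (d e : Fin k → ℕ) → powers ρ (λ i → d i + e i) ≡ powers ρ d * powers ρ e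
powers-+ []      d e = refl
powers-+ (x ∷ ρ) d e = trans
  (cong₂ _*_ (^-distribˡ-+-* x (d zero) (e zero)) (powers-+ ρ (d ∘ suc) (e ∘ suc)))
  ([m*n]*[o*p]≡[m*o]*[n*p] (x ^ d zero) (x ^ e zero) _ _)

^-distribʳ-* : ∀ a b n → (a * b) ^ n ≡ a ^ n * b ^ n
^-distribʳ-* a b zero    = refl
^-distribʳ-* a b (suc n) = trans (cong ((a * b) *_) (^-distribʳ-* a b n)) ([m*n]*[o*p]≡[m*o]*[n*p] a b (a ^ n) (b ^ n))

powers-* : ∀ {k} (ρ : Vec ℕ k) (d : Fin k → ℕ) n → powers ρ (λ i → d i * n) ≡ powers ρ d ^ n
powers-* []      d n = sym (^-zeroˡ n)
powers-* (x ∷ ρ) d n = trans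
  (cong₂ _*_ (sym (^-*-assoc x (d zero) n)) (powers-* ρ (d ∘ suc) n))
  (sym (^-distribʳ-* (x ^ d zero) _ n))

eval-powers : ∀ {k m} ρ σ (e : Monomial k m) → eval ρ σ e ≡ powers ρ (λ i → ⟦ degreeIn e i ⟧ σ)
eval-powers ρ σ (var i) = sym (powers-unit ρ σ i)
eval-powers ρ σ one     = sym (powers-0 ρ)
eval-powers ρ σ (e ⊗ f) = trans (cong₂ _*_ (eval-powers ρ σ e) (eval-powers ρ σ f)) (sym (powers-+ ρ _ _))
eval-powers ρ σ (e ↑ n) = trans (cong (_^ ⟦ n ⟧ σ) (eval-powers ρ σ e)) (sym (powers-* ρ _ (⟦ n ⟧ σ)))

-- The solver's normal forms of all exponents are gathered into one vector, so that a single `refl`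
-- settles every variable at once.
monomial-≡ : ∀ {k m} (ρ : Vec ℕ k) (σ : Vec ℕ m) (e f : Monomial k m) →
             Vec.tabulate (λ i → ⟦ degreeIn e i ⟧↓ σ) ≡ Vec.tabulate (λ i → ⟦ degreeIn f i ⟧↓ σ) →
             eval ρ σ e ≡ eval ρ σ f
monomial-≡ ρ σ e f h = trans (eval-powers ρ σ e) (trans (powers-cong ρ degrees) (sym (eval-powers ρ σ f)))
  where
  degrees : ∀ i → ⟦ degreeIn e i ⟧ σ ≡ ⟦ degreeIn f i ⟧ σ
  degrees i = prove σ (degreeIn e i) (degreeIn f i)
    (trans (sym (Vec.lookup∘tabulate _ i)) (trans (cong (λ v → lookup v i) h) (Vec.lookup∘tabulate _ i)))

pattern v0 = var zero
pattern v1 = var (suc zero)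
pattern v2 = var (suc (suc zero))
pattern v3 = var (suc (suc (suc zero)))
pattern v4 = var (suc (suc (suc (suc zero))))
pattern x0 = expv zero
pattern x1 = expv (suc zero)
pattern x2 = expv (suc (suc zero))
pattern x3 = expv (suc (suc (suc zero)))

-- Finite sums and products

module _ {A : Set} where

  ∑ ∏ : List A → (A → ℕ) → ℕ
  ∑ []       f = 0
  ∑ (x ∷ xs) f = f x + ∑ xs f
  ∏ []       f = 1
  ∏ (x ∷ xs) f = f x * ∏ xs f

  ∑-cong : ∀ xs {f g : A → ℕ} → (∀ x → f x ≡ g x) → ∑ xs f ≡ ∑ xs g
  ∑-cong []       h = refl
  ∑-cong (x ∷ xs) h = cong₂ _+_ (h x) (∑-cong xs h)

  ∏-cong : ∀ xs {f g : A → ℕ} → (∀ x → f x ≡ g x) → ∏ xs f ≡ ∏ xs g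
  ∏-cong []       h = refl
  ∏-cong (x ∷ xs) h = cong₂ _*_ (h x) (∏-cong xs h)

  ∑-mono : ∀ xs {f g : A → ℕ} → (∀ x → f x ≤ g x) → ∑ xs f ≤ ∑ xs g
  ∑-mono []       h = z≤n
  ∑-mono (x ∷ xs) h = +-mono-≤ (h x) (∑-mono xs h)

  ∏-mono : ∀ xs {f g : A → ℕ} → (∀ x → f x ≤ g x) → ∏ xs f ≤ ∏ xs g
  ∏-mono []       h = ≤-refl
  ∏-mono (x ∷ xs) h = *-mono-≤ (h x) (∏-mono xs h)

  ∑-0 : ∀ xs → ∑ xs (λ _ → 0) ≡ 0
  ∑-0 []       = refl
  ∑-0 (x ∷ xs) = ∑-0 xs

  ∏-1 : ∀ xs → ∏ xs (λ _ → 1) ≡ 1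
  ∏-1 []       = refl
  ∏-1 (x ∷ xs) = trans (+-identityʳ _) (∏-1 xs)

  ∑-+ : ∀ xs (f g : A → ℕ) → ∑ xs (λ x → f x + g x) ≡ ∑ xs f + ∑ xs g
  ∑-+ []       f g = refl
  ∑-+ (x ∷ xs) f g = trans (cong (f x + g x +_) (∑-+ xs f g)) ([m+n]+[o+p]≡[m+o]+[n+p] (f x) (g x) _ _)
    where
    [m+n]+[o+p]≡[m+o]+[n+p] : ∀ m n o p → m + n + (o + p) ≡ m + o + (n + p)
    [m+n]+[o+p]≡[m+o]+[n+p] = solve-∀

  ∏-* : ∀ xs (f g : A → ℕ) → ∏ xs (λ x → f x * g x) ≡ ∏ xs f * ∏ xs g
  ∏-* []       f g = refl
  ∏-* (x ∷ xs) f g = trans (cong (f x * g x *_) (∏-* xs f g)) ([m*n]*[o*p]≡[m*o]*[n*p] (f x) (g x) _ _)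

  ∑-*ˡ : ∀ xs c (f : A → ℕ) → ∑ xs (λ x → c * f x) ≡ c * ∑ xs f
  ∑-*ˡ []       c f = sym (*-zeroʳ c)
  ∑-*ˡ (x ∷ xs) c f = trans (cong (c * f x +_) (∑-*ˡ xs c f)) (sym (*-distribˡ-+ c (f x) _))

  ∑-*ʳ : ∀ xs c (f : A → ℕ) → ∑ xs (λ x → f x * c) ≡ ∑ xs f * c
  ∑-*ʳ xs c f = trans (∑-cong xs (λ x → *-comm (f x) c)) (trans (∑-*ˡ xs c f) (*-comm c _))

  ∏-^ : ∀ xs n (f : A → ℕ) → ∏ xs (λ x → f x ^ n) ≡ ∏ xs f ^ n
  ∏-^ []       n f = sym (^-zeroˡ n)
  ∏-^ (x ∷ xs) n f = trans (cong (f x ^ n *_) (∏-^ xs n f)) (sym (^-distribʳ-* (f x) _ n))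

  ∏-base^ : ∀ xs c (f : A → ℕ) → ∏ xs (λ x → c ^ f x) ≡ c ^ ∑ xs f
  ∏-base^ []       c f = refl
  ∏-base^ (x ∷ xs) c f = trans (cong (c ^ f x *_) (∏-base^ xs c f)) (sym (^-distribˡ-+-* c (f x) _))

  ∏>0 : ∀ xs (f : A → ℕ) → (∀ x → 0 < f x) → 0 < ∏ xs f
  ∏>0 []       f h = s≤s z≤n
  ∏>0 (x ∷ xs) f h = *-mono-≤ (h x) (∏>0 xs f h)

  ∑-++ : ∀ xs ys (f : A → ℕ) → ∑ (xs ++ ys) f ≡ ∑ xs f + ∑ ys f
  ∑-++ []       ys f = refl
  ∑-++ (x ∷ xs) ys f = trans (cong (f x +_) (∑-++ xs ys f)) (sym (+-assoc (f x) _ _))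

  ∏-++ : ∀ xs ys (f : A → ℕ) → ∏ (xs ++ ys) f ≡ ∏ xs f * ∏ ys f
  ∏-++ []       ys f = sym (+-identityʳ _)
  ∏-++ (x ∷ xs) ys f = trans (cong (f x *_) (∏-++ xs ys f)) (sym (*-assoc (f x) _ _))

module _ {A B : Set} where

  ∑-swap : ∀ (xs : List A) (ys : List B) (f : A → B → ℕ) →
           ∑ xs (λ x → ∑ ys (f x)) ≡ ∑ ys (λ y → ∑ xs (λ x → f x y))
  ∑-swap []       ys f = sym (∑-0 ys)
  ∑-swap (x ∷ xs) ys f = trans (cong (∑ ys (f x) +_) (∑-swap xs ys f)) (sym (∑-+ ys (f x) _))

  ∏-swap : ∀ (xs : List A) (ys : List B) (f : A → B → ℕ) →
           ∏ xs (λ x → ∏ ys (f x)) ≡ ∏ ys (λ y → ∏ xs (λ x → f x y))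
  ∏-swap []       ys f = sym (∏-1 ys)
  ∏-swap (x ∷ xs) ys f = trans (cong (∏ ys (f x) *_) (∏-swap xs ys f)) (sym (∏-* ys (f x) _))

  ∑-map : ∀ (h : B → A) ys (f : A → ℕ) → ∑ (map h ys) f ≡ ∑ ys (f ∘ h)
  ∑-map h []       f = refl
  ∑-map h (y ∷ ys) f = cong (f (h y) +_) (∑-map h ys f)

  ∏-map : ∀ (h : B → A) ys (f : A → ℕ) → ∏ (map h ys) f ≡ ∏ ys (f ∘ h)
  ∏-map h []       f = refl
  ∏-map h (y ∷ ys) f = cong (f (h y) *_) (∏-map h ys f)

  ∑-concatMap : ∀ (h : B → List A) ys (f : A → ℕ) → ∑ (concatMap h ys) f ≡ ∑ ys (λ y → ∑ (h y) f)
  ∑-concatMap h []       f = refl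
  ∑-concatMap h (y ∷ ys) f = trans (∑-++ (h y) _ f) (cong (∑ (h y) f +_) (∑-concatMap h ys f))

  ∏-concatMap : ∀ (h : B → List A) ys (f : A → ℕ) → ∏ (concatMap h ys) f ≡ ∏ ys (λ y → ∏ (h y) f)
  ∏-concatMap h []       f = refl
  ∏-concatMap h (y ∷ ys) f = trans (∏-++ (h y) _ f) (cong (∏ (h y) f *_) (∏-concatMap h ys f))

-- The weighted arithmetic-geometric mean inequality

^-cancelˡ-≤ : ∀ n {a b} → 0 < n → a ^ n ≤ b ^ n → a ≤ b
^-cancelˡ-≤ n {a} {b} n>0 h with a ≤? b
... | yes p = p
... | no ¬p = ⊥-elim (<⇒≱ (^-monoˡ-< n {{>-nonZero n>0}} (≰⇒> ¬p)) h)

*-cancelʳ-≤′ : ∀ {a b c} → 0 < c → a * c ≤ b * c → a ≤ b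
*-cancelʳ-≤′ {a} {b} {c} c>0 h = *-cancelʳ-≤ a b c {{>-nonZero c>0}} h

*-cancelˡ-≤′ : ∀ {a b c} → 0 < c → c * a ≤ c * b → a ≤ b
*-cancelˡ-≤′ {a} {b} {c} c>0 h = *-cancelˡ-≤ c {{>-nonZero c>0}} h

^>0 : ∀ {a} n → 0 < a → 0 < a ^ n
^>0 {a} n a>0 = m^n>0 a {{>-nonZero a>0}} n

n^n>0 : ∀ n → 0 < n ^ n
n^n>0 zero    = s≤s z≤n
n^n>0 (suc n) = ^>0 {suc n} (suc n) (s≤s z≤n)

2xy≤x²+y² : ∀ x y → 2 * (x * y) ≤ x * x + y * y
2xy≤x²+y² x y with ≤-total x y
... | inj₁ x≤y = subst (λ y → 2 * (x * y) ≤ x * x + y * y) (m+[n∸m]≡n x≤y)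
                   (subst (2 * (x * (x + k)) ≤_) (eq x k) (m≤m+n _ (k * k)))
  where
  k = y ∸ x
  eq : ∀ x k → 2 * (x * (x + k)) + k * k ≡ x * x + (x + k) * (x + k)
  eq = solve-∀
... | inj₂ y≤x = subst (λ x → 2 * (x * y) ≤ x * x + y * y) (m+[n∸m]≡n y≤x)
                   (subst (2 * ((y + k) * y) ≤_) (eq y k) (m≤m+n _ (k * k)))
  where
  k = x ∸ y
  eq : ∀ y k → 2 * ((y + k) * y) + k * k ≡ (y + k) * (y + k) + y * y
  eq = solve-∀

young : ∀ n x y → suc n * (x * y ^ n) ≤ x ^ suc n + n * y ^ suc n
young zero    x y = ≤-reflexive (eq x)
  where
  eq : ∀ x → 1 * (x * 1) ≡ x * 1 + 0
  eq = solve-∀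
-- Adding n x y^(n+1) to both sides makes the coefficient on the left 2(n+1), which fits 2xy ≤ x² +
-- y² and avoids subtraction.
young (suc n) x y = +-cancelʳ-≤ (n * (x * (y * y ^ n))) _ _ (begin
  suc (suc n) * (x * (y * Y)) + n * (x * (y * Y))     ≡⟨ eq₁ n x y Y ⟩
  suc n * Y * (2 * (x * y))                           ≤⟨ *-monoʳ-≤ (suc n * Y) (2xy≤x²+y² x y) ⟩
  suc n * Y * (x * x + y * y)                         ≡⟨ eq₂ n x y Y ⟩
  x * (suc n * (x * Y)) + suc n * (y * (y * Y))       ≤⟨ +-monoˡ-≤ _ (*-monoʳ-≤ x (young n x y)) ⟩
  x * (x * X + n * (y * Y)) + suc n * (y * (y * Y))   ≡⟨ eq₃ n x y X Y ⟩
  x * (x * X) + suc n * (y * (y * Y)) + n * (x * (y * Y)) ∎)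
  where
  open ≤-Reasoning
  X = x ^ n
  Y = y ^ n
  eq₁ : ∀ n x y Y → suc (suc n) * (x * (y * Y)) + n * (x * (y * Y)) ≡ suc n * Y * (2 * (x * y))
  eq₁ = solve-∀
  eq₂ : ∀ n x y Y → suc n * Y * (x * x + y * y) ≡ x * (suc n * (x * Y)) + suc n * (y * (y * Y))
  eq₂ = solve-∀
  eq₃ : ∀ n x y X Y → x * (x * X + n * (y * Y)) + suc n * (y * (y * Y)) ≡ x * (x * X) + suc n * (y * (y * Y)) + n * (x * (y * Y))
  eq₃ = solve-∀

-- AM-GM for `a` and n copies of s/n, cleared of denominators. It is `young` applied to the means (a
-- + s)/(n + 1) and s/n, both scaled by n(n + 1).
amgm-step : ∀ n s a → suc n ^ suc n * (a * s ^ n) ≤ n ^ n * (a + s) ^ suc n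
amgm-step zero    s a = ≤-trans (≤-reflexive (eq₁ a)) (≤-trans (m≤m+n a s) (≤-reflexive (eq₂ a s)))
  where
  eq₁ : ∀ a → 1 * (a * 1) ≡ a
  eq₁ = solve-∀
  eq₂ : ∀ a s → a + s ≡ 1 * ((a + s) * 1)
  eq₂ = solve-∀
amgm-step n@(suc _) s a = *-cancelˡ-≤ n (+-cancelʳ-≤ (n * y ^ suc n) _ _ (begin
  n * (suc n ^ suc n * (a * s ^ n)) + n * y ^ suc n         ≡⟨ cong₂ _+_ (eq₁ n (suc n ^ n) a (s ^ n)) (cong (λ z → n * (y * z)) yn) ⟩
  n * (suc n * a) * (suc n ^ n * s ^ n) + n * (y * (suc n ^ n * s ^ n)) ≡⟨ eq₂ n a s (suc n ^ n * s ^ n) ⟩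
  suc n * (x * (suc n ^ n * s ^ n))                          ≡⟨ cong (λ z → suc n * (x * z)) yn ⟨
  suc n * (x * y ^ n)                                        ≤⟨ young n x y ⟩
  x ^ suc n + n * y ^ suc n                                  ≡⟨ cong (_+ n * y ^ suc n) (trans (^-distribʳ-* n (a + s) (suc n)) (*-assoc n (n ^ n) _)) ⟩
  n * (n ^ n * (a + s) ^ suc n) + n * y ^ suc n              ∎))
  where
  open ≤-Reasoning
  x = n * (a + s)
  y = suc n * s
  yn : y ^ n ≡ suc n ^ n * s ^ n
  yn = ^-distribʳ-* (suc n) s n
  eq₁ : ∀ n N a S → n * (suc n * N * (a * S)) ≡ n * (suc n * a) * (N * S)
  eq₁ = solve-∀
  eq₂ : ∀ n a s Z → n * (suc n * a) * Z + n * (suc n * s * Z) ≡ suc n * (n * (a + s) * Z)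
  eq₂ = solve-∀

amgm : ∀ xs → length xs ^ length xs * product xs ≤ sum xs ^ length xs
amgm []       = ≤-refl
amgm (x ∷ xs) = *-cancelˡ-≤′ (n^n>0 n) (begin
  n ^ n * (suc n ^ suc n * (x * product xs)) ≡⟨ eq (n ^ n) (suc n ^ suc n) x (product xs) ⟩
  suc n ^ suc n * x * (n ^ n * product xs)   ≤⟨ *-monoʳ-≤ (suc n ^ suc n * x) (amgm xs) ⟩
  suc n ^ suc n * x * sum xs ^ n             ≡⟨ *-assoc (suc n ^ suc n) x _ ⟩
  suc n ^ suc n * (x * sum xs ^ n)           ≤⟨ amgm-step n (sum xs) x ⟩
  n ^ n * (x + sum xs) ^ suc n               ∎)
  where
  open ≤-Reasoning
  n = length xs
  eq : ∀ a b x p → a * (b * (x * p)) ≡ b * x * (a * p)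
  eq = solve-∀

sum-replicate : ∀ n x → sum (replicate n x) ≡ n * x
sum-replicate zero    x = refl
sum-replicate (suc n) x = cong (x +_) (sum-replicate n x)

product-replicate : ∀ n x → product (replicate n x) ≡ x ^ n
product-replicate zero    x = refl
product-replicate (suc n) x = cong (x *_) (product-replicate n x)

-- AM-GM for c copies of a / c and d copies of b / d, scaled by c d.
weighted-amgm-positive : ∀ c d a b → 0 < c → 0 < d → (c + d) ^ (c + d) * (a ^ c * b ^ d) ≤ (a + b) ^ (c + d) * (c ^ c * d ^ d)
weighted-amgm-positive c d a b c>0 d>0 = *-cancelʳ-≤′ (*-mono-≤ (^>0 d c>0) (^>0 c d>0)) (begin
  n ^ n * (a ^ c * b ^ d) * (c ^ d * d ^ c)      ≡⟨ monomial-≡ (n ∷ a ∷ b ∷ c ∷ d ∷ []) (c ∷ d ∷ [])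
       (v0 ↑ (x0 :+ x1) ⊗ (v1 ↑ x0 ⊗ v2 ↑ x1) ⊗ (v3 ↑ x1 ⊗ v4 ↑ x0)) (v0 ↑ (x0 :+ x1) ⊗ ((v1 ⊗ v4) ↑ x0 ⊗ (v2 ⊗ v3) ↑ x1)) refl ⟩
  n ^ n * ((a * d) ^ c * (b * c) ^ d)            ≡⟨ cong₂ (λ k p → k ^ k * p) (sym len)
                                                      (sym (trans (product-++ (replicate c (a * d)) _) (cong₂ _*_ (product-replicate c _) (product-replicate d _)))) ⟩
  length xs ^ length xs * product xs             ≤⟨ amgm xs ⟩
  sum xs ^ length xs                             ≡⟨ cong₂ _^_ (trans (sum-++ (replicate c (a * d)) _) (trans (cong₂ _+_ (sum-replicate c _) (sum-replicate d _)) (eq a b c d))) len ⟩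
  ((a + b) * (c * d)) ^ n                        ≡⟨ monomial-≡ ((a + b) ∷ c ∷ d ∷ []) (c ∷ d ∷ [])
       ((v0 ⊗ (v1 ⊗ v2)) ↑ (x0 :+ x1)) (v0 ↑ (x0 :+ x1) ⊗ (v1 ↑ x0 ⊗ v2 ↑ x1) ⊗ (v1 ↑ x1 ⊗ v2 ↑ x0)) refl ⟩
  (a + b) ^ n * (c ^ c * d ^ d) * (c ^ d * d ^ c) ∎)
  where
  open ≤-Reasoning
  n = c + d
  xs = replicate c (a * d) ++ replicate d (b * c)
  len : length xs ≡ n
  len = trans (length-++ (replicate c (a * d))) (cong₂ _+_ (length-replicate c) (length-replicate d))
  eq : ∀ a b c d → c * (a * d) + d * (b * c) ≡ (a + b) * (c * d)
  eq = solve-∀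

weighted-amgm : ∀ c d a b → (c + d) ^ (c + d) * (a ^ c * b ^ d) ≤ (a + b) ^ (c + d) * (c ^ c * d ^ d)
weighted-amgm zero d a b = begin
  d ^ d * (1 * b ^ d)       ≡⟨ eq (d ^ d) (b ^ d) ⟩
  b ^ d * (1 * d ^ d)       ≤⟨ *-monoˡ-≤ (1 * d ^ d) (^-monoˡ-≤ d (m≤n+m b a)) ⟩
  (a + b) ^ d * (1 * d ^ d) ∎
  where
  open ≤-Reasoning
  eq : ∀ x y → x * (1 * y) ≡ y * (1 * x)
  eq = solve-∀
weighted-amgm c@(suc _) zero a b = subst (λ n → n ^ n * (a ^ c * 1) ≤ (a + b) ^ n * (c ^ c * 1)) (sym (+-identityʳ c)) (begin
  c ^ c * (a ^ c * 1)       ≡⟨ eq (c ^ c) (a ^ c) ⟩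
  a ^ c * (c ^ c * 1)       ≤⟨ *-monoˡ-≤ (c ^ c * 1) (^-monoˡ-≤ c (m≤m+n a b)) ⟩
  (a + b) ^ c * (c ^ c * 1) ∎)
  where
  open ≤-Reasoning
  eq : ∀ x y → x * (y * 1) ≡ y * (x * 1)
  eq = solve-∀
weighted-amgm c@(suc _) d@(suc _) a b = weighted-amgm-positive c d a b (s≤s z≤n) (s≤s z≤n)

-- Hölder's inequality in dual form

-- The Gibbs variational form of  ∑ φ^(1/s) ≤ Y^(1/s)  without roots and logarithms: m ranges over unnormalised
-- probability weights.  The value 0 ^ 0 = 1 is what is needed at the boundary.
record GibbsBound {A : Set} (xs : List A) (s : ℕ) (φ : A → ℕ) (Y : ℕ) : Set where
  constructor gibbs
  field
    bound : ∀ m → ∑ xs m ^ (∑ xs m * s) * ∏ xs (λ x → φ x ^ m x) ≤ Y ^ ∑ xs m * ∏ xs (λ x → m x ^ m x) ^ s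
open GibbsBound

module _ {A : Set} where

  -- Gibbs' inequality ∑ p log(φ/p) ≤ log ∑ φ for p = m / ∑ m. Splitting off one element at a time
  -- leaves the two-point case, which is `weighted-amgm`.
  gibbs-∑ : ∀ (xs : List A) φ → GibbsBound xs 1 φ (∑ xs φ)
  gibbs-∑ xs φ .bound m = subst₂ (λ M N → ∑ xs m ^ M * ∏ xs (λ x → φ x ^ m x) ≤ ∑ xs φ ^ ∑ xs m * N)
                            (sym (*-identityʳ (∑ xs m))) (sym (^-identityʳ (∏ xs (λ x → m x ^ m x)))) (go xs)
    where
    open ≤-Reasoning
    eq₁ : ∀ a b c d → a * (b * c) * d ≡ a * b * (d * c)
    eq₁ = solve-∀
    eq₂ : ∀ a b z p → a * b * (z * p) ≡ a * (b * z) * p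
    eq₂ = solve-∀
    eq₃ : ∀ a b c p → a * (b * c) * p ≡ a * (b * p) * c
    eq₃ = solve-∀
    go : ∀ xs → ∑ xs m ^ ∑ xs m * ∏ xs (λ x → φ x ^ m x) ≤ ∑ xs φ ^ ∑ xs m * ∏ xs (λ x → m x ^ m x)
    go []       = ≤-refl
    go (x ∷ xs) = *-cancelʳ-≤′ (n^n>0 M) (begin
      (m x + M) ^ (m x + M) * (φ x ^ m x * ∏ xs (λ x → φ x ^ m x)) * M ^ M   ≡⟨ eq₁ E (φ x ^ m x) _ (M ^ M) ⟩
      (m x + M) ^ (m x + M) * φ x ^ m x * (M ^ M * ∏ xs (λ x → φ x ^ m x))   ≤⟨ *-monoʳ-≤ (E * φ x ^ m x) (go xs) ⟩
      (m x + M) ^ (m x + M) * φ x ^ m x * (Z ^ M * P)                        ≡⟨ eq₂ E (φ x ^ m x) (Z ^ M) P ⟩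
      (m x + M) ^ (m x + M) * (φ x ^ m x * Z ^ M) * P                        ≤⟨ *-monoˡ-≤ P (weighted-amgm (m x) M (φ x) Z) ⟩
      (φ x + Z) ^ (m x + M) * (m x ^ m x * M ^ M) * P                        ≡⟨ eq₃ ((φ x + Z) ^ (m x + M)) (m x ^ m x) (M ^ M) P ⟩
      (φ x + Z) ^ (m x + M) * (m x ^ m x * P) * M ^ M                        ∎)
      where
      M = ∑ xs m
      E = (m x + M) ^ (m x + M)
      Z = ∑ xs φ
      P = ∏ xs (λ x → m x ^ m x)

  -- The value s = 0 is the limiting case of the supremum norm. With c = 1 it starts the products in
  -- `wg-∏`.
  gibbs-const : ∀ (xs : List A) c → GibbsBound xs 0 (λ _ → c) c
  gibbs-const xs c .bound m = ≤-reflexive (subst₂ (λ k p → ∑ xs m ^ k * p ≡ c ^ ∑ xs m * 1)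
    (sym (*-zeroʳ (∑ xs m))) (sym (∏-base^ xs c m)) (trans (*-identityˡ _) (sym (*-identityʳ _))))

  -- This is Hölder's inequality: (∑ (φψ)^(1/(s+t)))^(s+t) ≤ (∑ φ^(1/s))^s (∑ ψ^(1/t))^t. In dual
  -- form both bounds are tested on the same `m` and multiplied.
  gibbs-* : ∀ {xs : List A} {s t φ ψ Y Z} → GibbsBound xs s φ Y → GibbsBound xs t ψ Z →
            GibbsBound xs (s + t) (λ x → φ x * ψ x) (Y * Z)
  gibbs-* {xs} {s} {t} {φ} {ψ} {Y} {Z} g h .bound m = begin
    M ^ (M * (s + t)) * ∏ xs (λ x → (φ x * ψ x) ^ m x)
      ≡⟨ cong (M ^ (M * (s + t)) *_) (trans (∏-cong xs (λ x → ^-distribʳ-* (φ x) (ψ x) (m x))) (∏-* xs _ _)) ⟩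
    M ^ (M * (s + t)) * (Φ * Ψ)
      ≡⟨ monomial-≡ (M ∷ Φ ∷ Ψ ∷ []) (M ∷ s ∷ t ∷ []) (v0 ↑ (x0 :* (x1 :+ x2)) ⊗ (v1 ⊗ v2)) (v0 ↑ (x0 :* x1) ⊗ v1 ⊗ (v0 ↑ (x0 :* x2) ⊗ v2)) refl ⟩
    M ^ (M * s) * Φ * (M ^ (M * t) * Ψ)
      ≤⟨ *-mono-≤ (g .bound m) (h .bound m) ⟩
    Y ^ M * P ^ s * (Z ^ M * P ^ t)
      ≡⟨ monomial-≡ (Y ∷ Z ∷ P ∷ []) (M ∷ s ∷ t ∷ []) (v0 ↑ x0 ⊗ v2 ↑ x1 ⊗ (v1 ↑ x0 ⊗ v2 ↑ x2)) ((v0 ⊗ v1) ↑ x0 ⊗ v2 ↑ (x1 :+ x2)) refl ⟩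
    (Y * Z) ^ M * P ^ (s + t) ∎
    where
    open ≤-Reasoning
    M = ∑ xs m
    P = ∏ xs (λ x → m x ^ m x)
    Φ = ∏ xs (λ x → φ x ^ m x)
    Ψ = ∏ xs (λ x → ψ x ^ m x)

  ∏-^-comm : ∀ (xs : List A) k (φ m : A → ℕ) → ∏ xs (λ x → (φ x ^ k) ^ m x) ≡ ∏ xs (λ x → φ x ^ m x) ^ k
  ∏-^-comm xs k φ m = trans (∏-cong xs (λ x → trans (^-*-assoc (φ x) k (m x))
    (trans (cong (φ x ^_) (*-comm k (m x))) (sym (^-*-assoc (φ x) (m x) k))))) (∏-^ xs k _)

  gibbs-lhs-^ : ∀ M s k Φ → M ^ (M * (s * k)) * Φ ^ k ≡ (M ^ (M * s) * Φ) ^ k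
  gibbs-lhs-^ M s k Φ = monomial-≡ (M ∷ Φ ∷ []) (M ∷ s ∷ k ∷ []) (v0 ↑ (x0 :* (x1 :* x2)) ⊗ v1 ↑ x2) ((v0 ↑ (x0 :* x1) ⊗ v1) ↑ x2) refl

  gibbs-rhs-^ : ∀ M s k Y P → (Y ^ M * P ^ s) ^ k ≡ (Y ^ k) ^ M * P ^ (s * k)
  gibbs-rhs-^ M s k Y P = monomial-≡ (Y ∷ P ∷ []) (M ∷ s ∷ k ∷ []) ((v0 ↑ x0 ⊗ v1 ↑ x1) ↑ x2) ((v0 ↑ x2) ↑ x0 ⊗ v1 ↑ (x1 :* x2)) refl

  gibbs-^ : ∀ {xs : List A} {s φ Y} k → GibbsBound xs s φ Y → GibbsBound xs (s * k) (λ x → φ x ^ k) (Y ^ k)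
  gibbs-^ {xs} {s} {φ} {Y} k g .bound m = begin
    M ^ (M * (s * k)) * ∏ xs (λ x → (φ x ^ k) ^ m x)   ≡⟨ cong (M ^ (M * (s * k)) *_) (∏-^-comm xs k φ m) ⟩
    M ^ (M * (s * k)) * ∏ xs (λ x → φ x ^ m x) ^ k     ≡⟨ gibbs-lhs-^ M s k _ ⟩
    (M ^ (M * s) * ∏ xs (λ x → φ x ^ m x)) ^ k         ≤⟨ ^-monoˡ-≤ k (g .bound m) ⟩
    (Y ^ M * P ^ s) ^ k                                ≡⟨ gibbs-rhs-^ M s k Y P ⟩
    (Y ^ k) ^ M * P ^ (s * k)                          ∎
    where
    open ≤-Reasoning
    M = ∑ xs m
    P = ∏ xs (λ x → m x ^ m x)

  gibbs-root : ∀ {xs : List A} {s φ Y} k → 0 < k → GibbsBound xs (s * k) (λ x → φ x ^ k) (Y ^ k) → GibbsBound xs s φ Y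
  gibbs-root {xs} {s} {φ} {Y} k k>0 g .bound m = ^-cancelˡ-≤ k k>0 (begin
    (M ^ (M * s) * ∏ xs (λ x → φ x ^ m x)) ^ k         ≡⟨ gibbs-lhs-^ M s k _ ⟨
    M ^ (M * (s * k)) * ∏ xs (λ x → φ x ^ m x) ^ k     ≡⟨ cong (M ^ (M * (s * k)) *_) (∏-^-comm xs k φ m) ⟨
    M ^ (M * (s * k)) * ∏ xs (λ x → (φ x ^ k) ^ m x)   ≤⟨ g .bound m ⟩
    (Y ^ k) ^ M * P ^ (s * k)                          ≡⟨ gibbs-rhs-^ M s k Y P ⟨
    (Y ^ M * P ^ s) ^ k                                ∎)
    where
    open ≤-Reasoning
    M = ∑ xs m
    P = ∏ xs (λ x → m x ^ m x)

  gibbs-resp : ∀ {xs : List A} {s t φ ψ Y Z} → s ≡ t → (∀ x → φ x ≡ ψ x) → Y ≡ Z → GibbsBound xs s φ Y → GibbsBound xs t ψ Z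
  gibbs-resp {xs} {s} {φ = φ} {ψ} {Y} refl h refl g .bound m =
    subst (λ p → ∑ xs m ^ (∑ xs m * s) * p ≤ Y ^ ∑ xs m * ∏ xs (λ x → m x ^ m x) ^ s)
      (∏-cong xs (λ x → cong (_^ m x) (h x))) (g .bound m)

  gibbs-∏ : ∀ {B : Set} {xs : List A} (vs : List B) {s : B → ℕ} {φ : B → A → ℕ} {Y : B → ℕ} →
            (∀ v → GibbsBound xs (s v) (φ v) (Y v)) → GibbsBound xs (∑ vs s) (λ x → ∏ vs (λ v → φ v x)) (∏ vs Y)
  gibbs-∏ {xs = xs} []       h = gibbs-const xs 1
  gibbs-∏           (v ∷ vs) h = gibbs-* (h v) (gibbs-∏ vs h)

  -- The weights m = g make the Gibbs bound sharp.
  gibbs⇒∑-bound : ∀ {xs : List A} {s φ Y} → GibbsBound xs s φ Y → 0 < s → ∀ κ κ′ (g : A → ℕ) →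
                  (∀ x → κ * g x ^ s ≤ κ′ * φ x) → κ * ∑ xs g ^ s ≤ κ′ * Y
  gibbs⇒∑-bound {xs} {s} {φ} {Y} G s>0 κ κ′ g h with 1 ≤? ∑ xs g
  ... | no ¬p = subst (λ M → κ * M ≤ κ′ * Y) (sym (trans (cong (_^ s) (n≤0⇒n≡0 (≤-pred (≰⇒> ¬p)))) (0^s s s>0)))
                  (≤-trans (≤-reflexive (*-zeroʳ κ)) z≤n)
    where
    0^s : ∀ s → 0 < s → 0 ^ s ≡ 0
    0^s (suc s) _ = refl
  ... | yes M>0 = ^-cancelˡ-≤ M M>0 (*-cancelʳ-≤′ (^>0 s (∏>0 xs _ (λ x → n^n>0 (g x)))) (begin
    (κ * M ^ s) ^ M * P ^ s
      ≡⟨ monomial-≡ (κ ∷ M ∷ P ∷ []) (M ∷ s ∷ []) ((v0 ⊗ v1 ↑ x1) ↑ x0 ⊗ v2 ↑ x1) (v1 ↑ (x0 :* x1) ⊗ (v0 ↑ x0 ⊗ v2 ↑ x1)) refl ⟩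
    M ^ (M * s) * (κ ^ M * P ^ s)
      ≡⟨ cong₂ (λ a b → M ^ (M * s) * (a * b)) (∏-base^ xs κ g) (∏-^-comm xs s g g) ⟨
    M ^ (M * s) * (∏ xs (λ x → κ ^ g x) * ∏ xs (λ x → (g x ^ s) ^ g x))
      ≡⟨ cong (M ^ (M * s) *_) (trans (∏-cong xs (λ x → ^-distribʳ-* κ (g x ^ s) (g x))) (∏-* xs _ _)) ⟨
    M ^ (M * s) * ∏ xs (λ x → (κ * g x ^ s) ^ g x)
      ≤⟨ *-monoʳ-≤ (M ^ (M * s)) (∏-mono xs (λ x → ^-monoˡ-≤ (g x) (h x))) ⟩
    M ^ (M * s) * ∏ xs (λ x → (κ′ * φ x) ^ g x)
      ≡⟨ cong (M ^ (M * s) *_) (trans (∏-cong xs (λ x → ^-distribʳ-* κ′ (φ x) (g x))) (∏-* xs _ _)) ⟩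
    M ^ (M * s) * (∏ xs (λ x → κ′ ^ g x) * Φ)
      ≡⟨ cong (λ a → M ^ (M * s) * (a * Φ)) (∏-base^ xs κ′ g) ⟩
    M ^ (M * s) * (κ′ ^ M * Φ)
      ≡⟨ eq (M ^ (M * s)) (κ′ ^ M) Φ ⟩
    κ′ ^ M * (M ^ (M * s) * Φ)
      ≤⟨ *-monoʳ-≤ (κ′ ^ M) (G .bound g) ⟩
    κ′ ^ M * (Y ^ M * P ^ s)
      ≡⟨ monomial-≡ (κ′ ∷ Y ∷ P ∷ []) (M ∷ s ∷ []) (v0 ↑ x0 ⊗ (v1 ↑ x0 ⊗ v2 ↑ x1)) ((v0 ⊗ v1) ↑ x0 ⊗ v2 ↑ x1) refl ⟩
    (κ′ * Y) ^ M * P ^ s ∎))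
    where
    open ≤-Reasoning
    M = ∑ xs g
    P = ∏ xs (λ x → g x ^ g x)
    Φ = ∏ xs (λ x → φ x ^ g x)
    eq : ∀ a b c → a * (b * c) ≡ b * (a * c)
    eq = solve-∀

  -- The (p+r)-th power of the summand is exactly (w f^(p+r))^p (w g^(p+r))^r, a product of the two
  -- kinds of factors to which `gibbs-*` applies.
  hölder : ∀ (xs : List A) (w f g : A → ℕ) p r → 0 < p + r →
           ∑ xs (λ x → w x * (f x ^ p * g x ^ r)) ^ (p + r) ≤
           ∑ xs (λ x → w x * f x ^ (p + r)) ^ p * ∑ xs (λ x → w x * g x ^ (p + r)) ^ r
  hölder xs w f g p r pos = subst₂ _≤_ (*-identityˡ _) (*-identityˡ _)
    (gibbs⇒∑-bound (gibbs-resp (cong₂ _+_ (*-identityˡ p) (*-identityˡ r)) (λ _ → refl) refl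
                     (gibbs-* (gibbs-^ p (gibbs-∑ xs _)) (gibbs-^ r (gibbs-∑ xs _))))
      pos 1 1 _ (λ x → *-monoʳ-≤ 1 (≤-reflexive (eq (w x) (f x) (g x)))))
    where
    eq : ∀ w f g → (w * (f ^ p * g ^ r)) ^ (p + r) ≡ (w * f ^ (p + r)) ^ p * (w * g ^ (p + r)) ^ r
    eq w f g = monomial-≡ (w ∷ f ∷ g ∷ []) (p ∷ r ∷ []) ((v0 ⊗ (v1 ↑ x0 ⊗ v2 ↑ x1)) ↑ (x0 :+ x1))
      ((v0 ⊗ v1 ↑ (x0 :+ x1)) ↑ x0 ⊗ (v0 ⊗ v2 ↑ (x0 :+ x1)) ↑ x1) refl

-- Approximate roots

-- Bernoulli's inequality (1 - 1/(M+1))^j ≥ 1 - j/(M+1), multiplied by (M+1)^(j+1).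
bernoulli : ∀ M j → suc M ^ suc j ≤ M ^ j * suc M + j * suc M ^ j
bernoulli M zero    = ≤-reflexive (eq M)
  where
  eq : ∀ M → suc M * 1 ≡ 1 * suc M + 0
  eq = solve-∀
bernoulli M (suc j) = begin
  suc M * (suc M * S)                                 ≡⟨ eq₁ M (suc M * S) ⟩
  M * (suc M * S) + suc M * S                         ≤⟨ +-monoˡ-≤ (suc M * S) (*-monoʳ-≤ M (bernoulli M j)) ⟩
  M * (M ^ j * suc M + j * S) + suc M * S             ≤⟨ m≤m+n _ (j * S) ⟩
  M * (M ^ j * suc M + j * S) + suc M * S + j * S     ≡⟨ eq₂ M (M ^ j) S j ⟩
  M * M ^ j * suc M + suc j * (suc M * S)             ∎
  where
  open ≤-Reasoning
  S = suc M ^ j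
  eq₁ : ∀ M z → suc M * z ≡ M * z + z
  eq₁ = solve-∀
  eq₂ : ∀ M R S j → M * (R * suc M + j * S) + suc M * S + j * S ≡ M * R * suc M + suc j * (suc M * S)
  eq₂ = solve-∀

-- A passage to the limit M → ∞ that needs a single value of M: at M = j(Y+1), Bernoulli gives
-- (Y+1)(M/(M+1))^j > Y, which excludes X ≥ Y + 1.
limit-≤ : ∀ j {X Y} → (∀ M → 0 < M → X * M ^ j ≤ suc M ^ j * Y) → X ≤ Y
limit-≤ zero    {X} {Y} h = subst₂ _≤_ (*-identityʳ X) (+-identityʳ Y) (h 1 (s≤s z≤n))
limit-≤ j@(suc _) {X} {Y} h with X ≤? Y
... | yes p = p
... | no ¬p = ⊥-elim (<⇒≱ (n<1+n M) (*-cancelʳ-≤′ {suc M} {M} {S} (^>0 {suc M} j (s≤s z≤n)) (+-cancelˡ-≤ (Y * (suc M * S)) _ _ (begin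
  Y * (suc M * S) + suc M * S                        ≡⟨ eq₁ Y M S ⟩
  suc Y * (suc M * S)                                ≤⟨ *-monoʳ-≤ (suc Y) (bernoulli M j) ⟩
  suc Y * (M ^ j * suc M + j * S)                    ≡⟨ eq₂ Y M (M ^ j) j S ⟩
  suc Y * M ^ j * suc M + j * suc Y * S              ≤⟨ +-monoˡ-≤ _ (*-monoˡ-≤ (suc M) (≤-trans (*-monoˡ-≤ (M ^ j) (≰⇒> ¬p)) (h M (s≤s z≤n)))) ⟩
  S * Y * suc M + M * S                              ≡⟨ eq₃ Y M S ⟩
  Y * (suc M * S) + M * S                            ∎))))
  where
  open ≤-Reasoning
  M = j * suc Y
  S = suc M ^ j
  eq₁ : ∀ Y M S → Y * (suc M * S) + suc M * S ≡ suc Y * (suc M * S)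
  eq₁ = solve-∀
  eq₂ : ∀ Y M R j S → suc Y * (R * suc M + j * S) ≡ suc Y * R * suc M + j * suc Y * S
  eq₂ = solve-∀
  eq₃ : ∀ Y M S → S * Y * suc M + M * S ≡ Y * (suc M * S) + M * S
  eq₃ = solve-∀

largest-below : ∀ (f : ℕ → ℕ) X B → f 0 ≤ X → X < f (suc B) → ∃[ t ] (f t ≤ X × X < f (suc t))
largest-below f X zero    lo hi = 0 , lo , hi
largest-below f X (suc B) lo hi with f (suc B) ≤? X
... | yes p = suc B , p , hi
... | no ¬p = largest-below f X B lo (≰⇒> ¬p)

-- C m / p has an integral Δ-th root up to a relative error of 1 / M.
approximate-root : ∀ Δ M p C m → 0 < Δ → 0 < M → p * M ^ Δ ≤ C →
                   ∃[ t ] (p * t ^ Δ ≤ C * m × (0 < p → 0 < m → M ^ Δ * (C * m) ≤ suc M ^ Δ * (p * t ^ Δ)))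
approximate-root Δ M zero    C m Δ>0 M>0 h = 0 , z≤n , (λ ())
approximate-root Δ@(suc Δ′) M p@(suc _) C m Δ>0 M>0 h
  with largest-below (λ t → p * t ^ Δ) (C * m) (C * m) (≤-trans (≤-reflexive (*-zeroʳ p)) z≤n)
         (≤-trans (m≤m*n (suc (C * m)) (suc (C * m) ^ Δ′) {{m^n≢0 (suc (C * m)) Δ′}}) (m≤n*m (suc (C * m) ^ Δ) p))
-- The largest admissible `t` is at least M because p M^Δ ≤ C ≤ C m; hence passing from t + 1 to t
-- costs at most the factor (M+1)/M.
... | t , lo , hi = t , lo , λ _ m>0 → begin
    M ^ Δ * (C * m)          ≤⟨ *-monoʳ-≤ (M ^ Δ) (<⇒≤ hi) ⟩
    M ^ Δ * (p * suc t ^ Δ)  ≡⟨ monomial-≡ (M ∷ p ∷ suc t ∷ []) (Δ ∷ []) (v0 ↑ x0 ⊗ (v1 ⊗ v2 ↑ x0)) (v1 ⊗ (v0 ⊗ v2) ↑ x0) refl ⟩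
    p * (M * suc t) ^ Δ      ≤⟨ *-monoʳ-≤ p (^-monoˡ-≤ Δ (step (M≤t m>0))) ⟩
    p * (suc M * t) ^ Δ      ≡⟨ monomial-≡ (suc M ∷ p ∷ t ∷ []) (Δ ∷ []) (v1 ⊗ (v0 ⊗ v2) ↑ x0) (v0 ↑ x0 ⊗ (v1 ⊗ v2 ↑ x0)) refl ⟩
    suc M ^ Δ * (p * t ^ Δ)  ∎
  where
  open ≤-Reasoning
  step : M ≤ t → M * suc t ≤ suc M * t
  step M≤t = subst (_≤ suc M * t) (sym (*-suc M t)) (+-monoˡ-≤ (M * t) M≤t)
  M≤t : 0 < m → M ≤ t
  M≤t m>0 with M ≤? t
  ... | yes q = q
  ... | no ¬q = ⊥-elim (<⇒≱ hi (≤-trans (*-monoʳ-≤ p (^-monoˡ-≤ Δ (≰⇒> ¬q))) (≤-trans h (m≤m*n C m {{>-nonZero m>0}}))))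

-- Sums over all maps between finite sets

∏-allFin-suc : ∀ a (f : Fin (suc a) → ℕ) → ∏ (allFin (suc a)) f ≡ f zero * ∏ (allFin a) (f ∘ suc)
∏-allFin-suc a f = cong (f zero *_) (trans (cong (λ l → ∏ l f) (sym (map-tabulate id suc))) (∏-map suc (allFin a) f))

∑-allFin-suc : ∀ a (f : Fin (suc a) → ℕ) → ∑ (allFin (suc a)) f ≡ f zero + ∑ (allFin a) (f ∘ suc)
∑-allFin-suc a f = cong (f zero +_) (trans (cong (λ l → ∑ l f) (sym (map-tabulate id suc))) (∑-map suc (allFin a) f))

∏-allFin-const : ∀ a c → ∏ (allFin a) (λ _ → c) ≡ c ^ a
∏-allFin-const zero    c = refl
∏-allFin-const (suc a) c = trans (∏-allFin-suc a (λ _ → c)) (cong (c *_) (∏-allFin-const a c))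

∑-allMaps-suc : ∀ a q (g : (Fin (suc a) → Fin q) → ℕ) →
                ∑ (allMaps (suc a) q) g ≡ ∑ (allFin q) (λ x → ∑ (allMaps a q) (λ f → g (extend x f)))
∑-allMaps-suc a q g = trans (∑-concatMap _ (allFin q) g) (∑-cong (allFin q) (λ x → ∑-map (extend x) (allMaps a q) g))

∑-∏ : ∀ a q (h : Fin a → Fin q → ℕ) →
      ∑ (allMaps a q) (λ f → ∏ (allFin a) (λ i → h i (f i))) ≡ ∏ (allFin a) (λ i → ∑ (allFin q) (h i))
∑-∏ zero    q h = refl
∑-∏ (suc a) q h = begin
  ∑ (allMaps (suc a) q) (λ f → ∏ (allFin (suc a)) (λ i → h i (f i)))
    ≡⟨ ∑-allMaps-suc a q _ ⟩
  ∑ (allFin q) (λ x → ∑ (allMaps a q) (λ f → ∏ (allFin (suc a)) (λ i → h i (extend x f i))))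
    ≡⟨ ∑-cong (allFin q) (λ x → trans (∑-cong (allMaps a q) (λ f → ∏-allFin-suc a (λ i → h i (extend x f i)))) (∑-*ˡ (allMaps a q) (h zero x) _)) ⟩
  ∑ (allFin q) (λ x → h zero x * ∑ (allMaps a q) (λ f → ∏ (allFin a) (λ i → h (suc i) (f i))))
    ≡⟨ ∑-*ʳ (allFin q) _ (h zero) ⟩
  ∑ (allFin q) (h zero) * ∑ (allMaps a q) (λ f → ∏ (allFin a) (λ i → h (suc i) (f i)))
    ≡⟨ cong (∑ (allFin q) (h zero) *_) (∑-∏ a q (h ∘ suc)) ⟩
  ∑ (allFin q) (h zero) * ∏ (allFin a) (λ i → ∑ (allFin q) (h (suc i)))
    ≡⟨ ∏-allFin-suc a (λ i → ∑ (allFin q) (h i)) ⟨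
  ∏ (allFin (suc a)) (λ i → ∑ (allFin q) (h i)) ∎
  where open ≡-Reasoning

∑-allFin-≥ : ∀ q (f : Fin q → ℕ) x → f x ≤ ∑ (allFin q) f
∑-allFin-≥ (suc q) f zero    = m≤m+n (f zero) _
∑-allFin-≥ (suc q) f (suc x) = ≤-trans (≤-trans (∑-allFin-≥ q (f ∘ suc) x) (m≤n+m _ (f zero))) (≤-reflexive (sym (∑-allFin-suc q f)))

bit : Bool → ℕ
bit false = 0
bit true  = 1

ne : ∀ {q} → Fin q → Fin q → ℕ
ne x y = bit (not ⌊ x ≟ y ⌋)

ne-comm : ∀ {q} (x y : Fin q) → ne x y ≡ ne y x
ne-comm x y with x ≟ y | y ≟ x
... | yes _ | yes _ = refl
... | no  _ | no  _ = refl
... | yes p | no ¬q = ⊥-elim (¬q (sym p))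
... | no ¬p | yes q = ⊥-elim (¬p (sym q))

ne≤1 : ∀ {q} (x y : Fin q) → ne x y ≤ 1
ne≤1 x y with x ≟ y
... | yes _ = z≤n
... | no  _ = ≤-refl

-- Weighted colourings of complete bipartite graphs

module _ {q : ℕ} where

  total : (Fin q → ℕ) → ℕ
  total = ∑ (allFin q)

  _∖_ : (Fin q → ℕ) → Fin q → (Fin q → ℕ)
  (l ∖ x) y = l y * ne x y

  wt : ∀ {a} → (Fin q → ℕ) → (Fin a → Fin q) → ℕ
  wt {a} l f = ∏ (allFin a) (λ i → l (f i))

  avoids : ∀ {a} → (Fin a → Fin q) → Fin q → ℕ
  avoids {a} f z = ∏ (allFin a) (λ i → ne (f i) z)

  -- Colourings of K_{a,b} in which the a vertices have the list l and the b vertices the list m (N a b l m above).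
  biclique : ℕ → ℕ → (l m : Fin q → ℕ) → ℕ
  biclique a b l m = ∑ (allMaps a q) (λ f → wt l f * total (λ z → m z * avoids f z) ^ b)

  total-^ : ∀ b (h : Fin q → ℕ) → total h ^ b ≡ ∑ (allMaps b q) (wt h)
  total-^ b h = trans (sym (∏-allFin-const b (total h))) (sym (∑-∏ b q (λ _ → h)))

  biclique-expand : ∀ a b l m → biclique a b l m ≡
    ∑ (allMaps a q) (λ f → ∑ (allMaps b q) (λ g → wt l f * (wt m g * ∏ (allFin b) (λ j → ∏ (allFin a) (λ i → ne (f i) (g j))))))
  biclique-expand a b l m = ∑-cong (allMaps a q) (λ f → trans
    (cong (wt l f *_) (trans (total-^ b _) (∑-cong (allMaps b q) (λ g → ∏-* (allFin b) (λ j → m (g j)) (λ j → avoids f (g j))))))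
    (sym (∑-*ˡ (allMaps b q) (wt l f) _)))

  -- Expanding the b-th power into a sum over colourings of the other side makes the two sides play
  -- the same role. This symmetry is what allows Hölder to be applied once on each side.
  biclique-comm : ∀ a b l m → biclique a b l m ≡ biclique b a m l
  biclique-comm a b l m = trans (biclique-expand a b l m) (trans (∑-swap (allMaps a q) (allMaps b q) _) (trans
    (∑-cong (allMaps b q) (λ g → ∑-cong (allMaps a q) (λ f → trans
      (cong (λ X → wt l f * (wt m g * X)) (trans (∏-swap (allFin b) (allFin a) _)
         (∏-cong (allFin a) (λ i → ∏-cong (allFin b) (λ j → ne-comm (f i) (g j))))))
      (x[yz]≡y[xz] (wt l f) (wt m g) _))))
    (sym (biclique-expand b a m l))))
    where
    x[yz]≡y[xz] : ∀ x y z → x * (y * z) ≡ y * (x * z)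
    x[yz]≡y[xz] = solve-∀

  wt-* : ∀ {a} (l m : Fin q → ℕ) (f : Fin a → Fin q) → wt (λ x → l x * m x) f ≡ wt l f * wt m f
  wt-* {a} l m f = ∏-* (allFin a) _ _

  wt-∖ : ∀ {a} l x (f : Fin a → Fin q) → wt (l ∖ x) f ≡ wt l f * avoids f x
  wt-∖ {a} l x f = trans (∏-* (allFin a) _ _) (cong (wt l f *_) (∏-cong (allFin a) (λ i → ne-comm x (f i))))

  -- `K f` stands for the weight that `f` leaves to one vertex of the opposite side. Kept abstract,
  -- it serves `edge-bound`, with the colours of U avoided by `f`, and also `total-bound`, with K =
  -- 1. Writing Δ as e + a makes both Hölder exponents visible without subtraction.
  module Local (W l : Fin q → ℕ) (a e β : ℕ) (K : (Fin a → Fin q) → ℕ) (a>0 : 0 < a) where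

    private
      Δ = e + a
      b = suc β
      Q = ∑ (allMaps a q) (λ f → wt l f * K f ^ b)
      N = biclique b Δ W l
      open ≤-Reasoning

    S : Fin q → ℕ
    S x = ∑ (allMaps a q) (λ f → wt (l ∖ x) f * K f ^ β)

    module _ (t : Fin q → ℕ) where

      private
        u : Fin q → ℕ
        u x = W x * t x ^ e
        D : (Fin a → Fin q) → ℕ
        D f = total (λ x → u x * avoids f x)
        R = total (λ x → W x * t x ^ Δ)

      -- Seen from `f`, x is the colour of one more opposite vertex, with list `u`. Summing over x
      -- first turns it into the factor `D f`.
      ∑-exchange : total (λ x → W x * (t x ^ e * S x)) ≡ ∑ (allMaps a q) (λ f → wt l f * (D f ^ 1 * K f ^ β))
      ∑-exchange = begin-equality
        total (λ x → W x * (t x ^ e * S x))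
          ≡⟨ ∑-cong (allFin q) (λ x → trans (sym (*-assoc (W x) (t x ^ e) (S x))) (sym (∑-*ˡ (allMaps a q) (u x) _))) ⟩
        total (λ x → ∑ (allMaps a q) (λ f → u x * (wt (l ∖ x) f * K f ^ β)))
          ≡⟨ ∑-swap (allFin q) (allMaps a q) _ ⟩
        ∑ (allMaps a q) (λ f → total (λ x → u x * (wt (l ∖ x) f * K f ^ β)))
          ≡⟨ ∑-cong (allMaps a q) (λ f → trans (∑-cong (allFin q) (λ x → trans
               (cong (λ z → u x * (z * K f ^ β)) (wt-∖ l x f)) (eq₁ (u x) (wt l f) (avoids f x) (K f ^ β))))
               (trans (∑-*ʳ (allFin q) (wt l f * K f ^ β) _) (eq₂ (D f) (wt l f) (K f ^ β)))) ⟩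
        ∑ (allMaps a q) (λ f → wt l f * (D f ^ 1 * K f ^ β)) ∎
        where
        eq₁ : ∀ u w v k → u * (w * v * k) ≡ u * v * (w * k)
        eq₁ = solve-∀
        eq₂ : ∀ D w k → D * (w * k) ≡ w * (D * 1 * k)
        eq₂ = solve-∀

      -- On the opposite side the list u = W t^e splits into `wt W g` and `wt t g ^ e`. Hölder with
      -- exponents e and a separates t, whose sum decouples into R^b, from `L`, whose sum is N.
      hölder-dual : biclique b a u l ^ Δ ≤ (R ^ b) ^ e * N ^ a
      hölder-dual = subst₂ (λ x y → x ^ Δ ≤ y ^ e * N ^ a)
        (∑-cong (allMaps b q) (λ g → trans (sym (*-assoc (wt W g) _ _)) (cong (_* L g ^ a) (sym (trans (wt-* W (λ x → t x ^ e) g)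
           (cong (wt W g *_) (∏-^ (allFin b) e (λ j → t (g j)))))))))
        (sym (trans (total-^ b (λ x → W x * t x ^ Δ)) (∑-cong (allMaps b q) (λ g → trans (wt-* W (λ x → t x ^ Δ) g)
           (cong (wt W g *_) (∏-^ (allFin b) Δ (λ j → t (g j))))))))
        (hölder (allMaps b q) (wt W) (wt t) L e a (≤-trans a>0 (m≤n+m a e)))
        where
        L : (Fin b → Fin q) → ℕ
        L g = total (λ z → l z * avoids g z)

      -- The claim of `local` tested against an arbitrary t: by duality, maximising over t with R
      -- fixed yields the norm of S with exponent Δ/a. The first Hölder inequality separates `D`
      -- from K^β; the sum of D^b is a biclique with list `u`, to which `hölder-dual` applies.
      two-hölders : total (λ x → W x * (t x ^ e * S x)) ^ (b * Δ) ≤ N ^ a * Q ^ (β * Δ) * R ^ (b * e)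
      two-hölders = begin
        total (λ x → W x * (t x ^ e * S x)) ^ (b * Δ)  ≡⟨ cong (_^ (b * Δ)) ∑-exchange ⟩
        Y ^ (b * Δ)                                    ≡⟨ ^-*-assoc Y b Δ ⟨
        (Y ^ b) ^ Δ                                    ≤⟨ ^-monoˡ-≤ Δ (hölder (allMaps a q) (wt l) D K 1 β (s≤s z≤n)) ⟩
        (biclique a b l u ^ 1 * Q ^ β) ^ Δ             ≡⟨ cong (λ z → (z ^ 1 * Q ^ β) ^ Δ) (biclique-comm a b l u) ⟩
        (biclique b a u l ^ 1 * Q ^ β) ^ Δ             ≡⟨ monomial-≡ (biclique b a u l ∷ Q ∷ []) (β ∷ Δ ∷ [])
                                                            ((v0 ↑ con 1 ⊗ v1 ↑ x0) ↑ x1) (v0 ↑ x1 ⊗ v1 ↑ (x0 :* x1)) refl ⟩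
        biclique b a u l ^ Δ * Q ^ (β * Δ)             ≤⟨ *-monoˡ-≤ (Q ^ (β * Δ)) hölder-dual ⟩
        (R ^ b) ^ e * N ^ a * Q ^ (β * Δ)              ≡⟨ cong (λ z → z * N ^ a * Q ^ (β * Δ)) (^-*-assoc R b e) ⟩
        R ^ (b * e) * N ^ a * Q ^ (β * Δ)              ≡⟨ eq (R ^ (b * e)) (N ^ a) (Q ^ (β * Δ)) ⟩
        N ^ a * Q ^ (β * Δ) * R ^ (b * e)              ∎
        where
        Y = ∑ (allMaps a q) (λ f → wt l f * (D f ^ 1 * K f ^ β))
        eq : ∀ x y z → x * y * z ≡ y * z * x
        eq = solve-∀

    -- The two Hölder inequalities are applied with t = (m / W)^(1/Δ), up to a factor 1 + 1/M.
    local : GibbsBound (allFin q) (a * b) (λ x → W x ^ (a * b) * S x ^ (b * Δ)) (N ^ a * Q ^ (β * Δ))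
    -- Each approximate root enters with an error ((M+1)/M)^(Δ b e), raised to the power `m x`; over
    -- all x this adds up to the exponent given here.
    local .bound m = limit-≤ (Δ * (b * e) * mt) approx
      where
      mt = total m
      P = ∏ (allFin q) (λ x → m x ^ m x)
      φ : Fin q → ℕ
      φ x = W x ^ (a * b) * S x ^ (b * Δ)
      Φ = ∏ (allFin q) (λ x → φ x ^ m x)
      N′ = N ^ a * Q ^ (β * Δ)
      approx : ∀ M → 0 < M → mt ^ (mt * (a * b)) * Φ * M ^ (Δ * (b * e) * mt) ≤ suc M ^ (Δ * (b * e) * mt) * (N′ ^ mt * P ^ (a * b))
      approx M M>0 = *-cancelʳ-≤′ Z>0 (begin
        mt ^ (mt * (a * b)) * Φ * M ^ (Δ * (b * e) * mt) * Z
          ≡⟨ monomial-≡ (mt ∷ Φ ∷ M ∷ C ∷ P ∷ []) (a ∷ b ∷ e ∷ mt ∷ [])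
               (v0 ↑ (x3 :* (x0 :* x1)) ⊗ v1 ⊗ v2 ↑ ((x2 :+ x0) :* (x1 :* x2) :* x3) ⊗ ((v3 ↑ x3) ↑ (x1 :* x2) ⊗ (v0 ↑ x3) ↑ (x1 :* x2) ⊗ v4 ↑ (x1 :* x2)))
               (v0 ↑ (x3 :* (x1 :* (x2 :+ x0))) ⊗ ((v3 ↑ (x1 :* x2) ⊗ v2 ↑ ((x2 :+ x0) :* (x1 :* x2))) ↑ x3 ⊗ v4 ↑ (x1 :* x2) ⊗ v1)) refl ⟩
        mt ^ (mt * (b * Δ)) * ((C ^ (b * e) * M ^ (Δ * (b * e))) ^ mt * P ^ (b * e) * Φ)
          ≤⟨ *-monoʳ-≤ (mt ^ (mt * (b * Δ))) pointwise ⟩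
        mt ^ (mt * (b * Δ)) * ((suc M ^ (Δ * (b * e))) ^ mt * Ψ)
          ≡⟨ eq (mt ^ (mt * (b * Δ))) ((suc M ^ (Δ * (b * e))) ^ mt) Ψ ⟩
        (suc M ^ (Δ * (b * e))) ^ mt * (mt ^ (mt * (b * Δ)) * Ψ)
          ≤⟨ *-monoʳ-≤ ((suc M ^ (Δ * (b * e))) ^ mt) gibbs-Y ⟩
        (suc M ^ (Δ * (b * e))) ^ mt * ((N′ * (C * mt) ^ (b * e)) ^ mt * P ^ (b * Δ))
          ≡⟨ monomial-≡ (mt ∷ N′ ∷ suc M ∷ C ∷ P ∷ []) (a ∷ b ∷ e ∷ mt ∷ [])
               ((v2 ↑ ((x2 :+ x0) :* (x1 :* x2))) ↑ x3 ⊗ ((v1 ⊗ (v3 ⊗ v0) ↑ (x1 :* x2)) ↑ x3 ⊗ v4 ↑ (x1 :* (x2 :+ x0))))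
               (v2 ↑ ((x2 :+ x0) :* (x1 :* x2) :* x3) ⊗ (v1 ↑ x3 ⊗ v4 ↑ (x0 :* x1)) ⊗ ((v3 ↑ x3) ↑ (x1 :* x2) ⊗ (v0 ↑ x3) ↑ (x1 :* x2) ⊗ v4 ↑ (x1 :* x2))) refl ⟩
        suc M ^ (Δ * (b * e) * mt) * (N′ ^ mt * P ^ (a * b)) * Z ∎)
        where
        eq : ∀ x y z → x * (y * z) ≡ y * (x * z)
        eq = solve-∀
        -- The scale `C` ensures W x · M^Δ ≤ C for every x, as `approximate-root` requires; `suc`
        -- keeps C positive, so that `Z` can be cancelled.
        C = suc (total W) * M ^ Δ
        Z = (C ^ mt) ^ (b * e) * (mt ^ mt) ^ (b * e) * P ^ (b * e)
        C>0 : 0 < C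
        C>0 = *-mono-≤ {1} {suc (total W)} (s≤s z≤n) (^>0 Δ M>0)
        Z>0 : 0 < Z
        Z>0 = *-mono-≤ (*-mono-≤ (^>0 (b * e) (^>0 mt C>0)) (^>0 (b * e) (n^n>0 mt))) (^>0 (b * e) (∏>0 (allFin q) _ (λ x → n^n>0 (m x))))
        root : ∀ x → ∃[ s ] (W x * s ^ Δ ≤ C * m x × (0 < W x → 0 < m x → M ^ Δ * (C * m x) ≤ suc M ^ Δ * (W x * s ^ Δ)))
        root x = approximate-root Δ M (W x) C (m x) (≤-trans a>0 (m≤n+m a e)) M>0
                   (*-monoˡ-≤ (M ^ Δ) (≤-trans (∑-allFin-≥ q W x) (n≤1+n _)))
        t : Fin q → ℕ
        t x = proj₁ (root x)
        ψ : Fin q → ℕ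
        ψ x = W x * (t x ^ e * S x)
        Ψ = ∏ (allFin q) (λ x → (ψ x ^ (b * Δ)) ^ m x)
        gibbs-Y : mt ^ (mt * (b * Δ)) * Ψ ≤ (N′ * (C * mt) ^ (b * e)) ^ mt * P ^ (b * Δ)
        gibbs-Y = begin
          mt ^ (mt * (b * Δ)) * Ψ                       ≤⟨ gibbs-resp (*-identityˡ (b * Δ)) (λ _ → refl) refl (gibbs-^ (b * Δ) (gibbs-∑ (allFin q) ψ)) .bound m ⟩
          (total ψ ^ (b * Δ)) ^ mt * P ^ (b * Δ)        ≤⟨ *-monoˡ-≤ (P ^ (b * Δ)) (^-monoˡ-≤ mt (two-hölders t)) ⟩
          (N′ * total (λ x → W x * t x ^ Δ) ^ (b * e)) ^ mt * P ^ (b * Δ)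
            ≤⟨ *-monoˡ-≤ (P ^ (b * Δ)) (^-monoˡ-≤ mt (*-monoʳ-≤ N′ (^-monoˡ-≤ (b * e)
                 (≤-trans (∑-mono (allFin q) (λ x → proj₁ (proj₂ (root x)))) (≤-reflexive (∑-*ˡ (allFin q) C m)))))) ⟩
          (N′ * (C * mt) ^ (b * e)) ^ mt * P ^ (b * Δ)  ∎
        c₁ = C ^ (b * e) * M ^ (Δ * (b * e))
        c₂ = suc M ^ (Δ * (b * e))
        -- Since bΔ = be + ab, ψ^(bΔ) equals (W t^Δ)^(be) φ, and W t^Δ approximates C m. If m x = 0,
        -- both sides are 1; if W x = 0, then φ x = 0.
        at : ∀ x → (c₁ * (m x ^ (b * e) * φ x)) ^ m x ≤ (c₂ * ψ x ^ (b * Δ)) ^ m x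
        at x = at-weight (m x) (proj₂ (proj₂ (root x)))
          where
          at-weight : ∀ k → (0 < W x → 0 < k → M ^ Δ * (C * k) ≤ suc M ^ Δ * (W x * t x ^ Δ)) →
                      (c₁ * (k ^ (b * e) * φ x)) ^ k ≤ (c₂ * ψ x ^ (b * Δ)) ^ k
          at-weight zero    h = ≤-refl
          at-weight (suc k) h = ^-monoˡ-≤ (suc k) (at-positive (W x) h)
            where
            at-positive : ∀ w → (0 < w → 0 < suc k → M ^ Δ * (C * suc k) ≤ suc M ^ Δ * (w * t x ^ Δ)) →
                          c₁ * (suc k ^ (b * e) * (w ^ (a * b) * S x ^ (b * Δ))) ≤ c₂ * (w * (t x ^ e * S x)) ^ (b * Δ)
            at-positive zero    h = ≤-trans (≤-reflexive (trans (cong (λ z → c₁ * (suc k ^ (b * e) * (z * S x ^ (b * Δ)))) (0^ab a>0))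
                                       (trans (cong (c₁ *_) (*-zeroʳ (suc k ^ (b * e)))) (*-zeroʳ c₁)))) z≤n
              where
              0^ab : ∀ {a} → 0 < a → 0 ^ (a * b) ≡ 0
              0^ab {suc a} _ = refl
            at-positive w@(suc _) h = begin
              c₁ * (suc k ^ (b * e) * (w ^ (a * b) * S x ^ (b * Δ)))
                ≡⟨ monomial-≡ (C ∷ M ∷ suc k ∷ w ∷ S x ∷ []) (a ∷ b ∷ e ∷ [])
                     (v0 ↑ (x1 :* x2) ⊗ v1 ↑ ((x2 :+ x0) :* (x1 :* x2)) ⊗ (v2 ↑ (x1 :* x2) ⊗ (v3 ↑ (x0 :* x1) ⊗ v4 ↑ (x1 :* (x2 :+ x0)))))
                     ((v1 ↑ (x2 :+ x0) ⊗ (v0 ⊗ v2)) ↑ (x1 :* x2) ⊗ (v3 ↑ (x0 :* x1) ⊗ v4 ↑ (x1 :* (x2 :+ x0)))) refl ⟩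
              (M ^ Δ * (C * suc k)) ^ (b * e) * (w ^ (a * b) * S x ^ (b * Δ))
                ≤⟨ *-monoˡ-≤ (w ^ (a * b) * S x ^ (b * Δ)) (^-monoˡ-≤ (b * e) (h (s≤s z≤n) (s≤s z≤n))) ⟩
              (suc M ^ Δ * (w * t x ^ Δ)) ^ (b * e) * (w ^ (a * b) * S x ^ (b * Δ))
                ≡⟨ monomial-≡ (suc M ∷ t x ∷ w ∷ S x ∷ []) (a ∷ b ∷ e ∷ [])
                     ((v0 ↑ (x2 :+ x0) ⊗ (v2 ⊗ v1 ↑ (x2 :+ x0))) ↑ (x1 :* x2) ⊗ (v2 ↑ (x0 :* x1) ⊗ v3 ↑ (x1 :* (x2 :+ x0))))
                     (v0 ↑ ((x2 :+ x0) :* (x1 :* x2)) ⊗ (v2 ⊗ (v1 ↑ x2 ⊗ v3)) ↑ (x1 :* (x2 :+ x0))) refl ⟩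
              c₂ * (w * (t x ^ e * S x)) ^ (b * Δ) ∎
        pointwise : c₁ ^ mt * P ^ (b * e) * Φ ≤ c₂ ^ mt * Ψ
        pointwise = begin
          c₁ ^ mt * P ^ (b * e) * Φ
            ≡⟨ trans (*-assoc (c₁ ^ mt) _ _) (cong₂ (λ u v → u * (v * Φ)) (sym (∏-base^ (allFin q) c₁ m)) (sym (∏-^-comm (allFin q) (b * e) m m))) ⟩
          ∏ (allFin q) (λ x → c₁ ^ m x) * (∏ (allFin q) (λ x → (m x ^ (b * e)) ^ m x) * Φ)
            ≡⟨ cong (∏ (allFin q) (λ x → c₁ ^ m x) *_) (∏-* (allFin q) _ _) ⟨
          ∏ (allFin q) (λ x → c₁ ^ m x) * ∏ (allFin q) (λ x → (m x ^ (b * e)) ^ m x * φ x ^ m x)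
            ≡⟨ ∏-* (allFin q) _ _ ⟨
          ∏ (allFin q) (λ x → c₁ ^ m x * ((m x ^ (b * e)) ^ m x * φ x ^ m x))
            ≡⟨ ∏-cong (allFin q) (λ x → trans (^-distribʳ-* c₁ _ (m x)) (cong (c₁ ^ m x *_) (^-distribʳ-* (m x ^ (b * e)) (φ x) (m x)))) ⟨
          ∏ (allFin q) (λ x → (c₁ * (m x ^ (b * e) * φ x)) ^ m x)
            ≤⟨ ∏-mono (allFin q) at ⟩
          ∏ (allFin q) (λ x → (c₂ * ψ x ^ (b * Δ)) ^ m x)
            ≡⟨ trans (∏-cong (allFin q) (λ x → ^-distribʳ-* c₂ (ψ x ^ (b * Δ)) (m x))) (∏-* (allFin q) _ _) ⟩
          ∏ (allFin q) (λ x → c₂ ^ m x) * Ψ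
            ≡⟨ cong (_* Ψ) (∏-base^ (allFin q) c₂ m) ⟩
          c₂ ^ mt * Ψ ∎

-- Removing a colour from the lists of a single edge

ne-suc : ∀ {n} (x y : Fin n) → ne (suc x) (suc y) ≡ ne x y
ne-suc x y with x ≟ y
... | yes _ = refl
... | no  _ = refl

∑-split : ∀ {q} (f : Fin q → ℕ) x → ∑ (allFin q) f ≡ ∑ (allFin q) (λ y → f y * ne x y) + f x
∑-split {suc q} f zero = trans (∑-allFin-suc q f) (trans (+-comm (f zero) _) (cong (_+ f zero) (sym
  (trans (∑-allFin-suc q _) (cong₂ _+_ (*-zeroʳ (f zero)) (∑-cong (allFin q) (λ y → *-identityʳ (f (suc y)))))))))
∑-split {suc q} f (suc x) = begin
  ∑ (allFin (suc q)) f                                                     ≡⟨ ∑-allFin-suc q f ⟩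
  f zero + ∑ (allFin q) (f ∘ suc)                                          ≡⟨ cong (f zero +_) (∑-split (f ∘ suc) x) ⟩
  f zero + (∑ (allFin q) (λ y → f (suc y) * ne x y) + f (suc x))           ≡⟨ +-assoc (f zero) _ _ ⟨
  f zero + ∑ (allFin q) (λ y → f (suc y) * ne x y) + f (suc x)
    ≡⟨ cong (_+ f (suc x)) (cong₂ _+_ (sym (*-identityʳ (f zero))) (∑-cong (allFin q) (λ y → cong (f (suc y) *_) (sym (ne-suc x y))))) ⟩
  f zero * 1 + ∑ (allFin q) (λ y → f (suc y) * ne (suc x) (suc y)) + f (suc x) ≡⟨ cong (_+ f (suc x)) (∑-allFin-suc q _) ⟨
  ∑ (allFin (suc q)) (λ y → f y * ne (suc x) y) + f (suc x)                ∎
  where open ≡-Reasoning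

module _ {q : ℕ} where

  -- ∑_x W x · N a β (V∖x) U ^ (Δ/a)  ≤  N b Δ W V ^ (1/b) · N a b V U ^ (βΔ/(ab))
  edge-bound : ∀ (W V U : Fin q → ℕ) {a Δ} β → 0 < a → a ≤ Δ → let b = suc β in
    GibbsBound (allFin q) (a * b) (λ x → W x ^ (a * b) * biclique a β (V ∖ x) U ^ (b * Δ))
      (biclique b Δ W V ^ a * biclique a b V U ^ (β * Δ))
  edge-bound W V U {a} {Δ} β a>0 a≤Δ = subst
    (λ Δ → GibbsBound (allFin q) (a * suc β) (λ x → W x ^ (a * suc β) * biclique a β (V ∖ x) U ^ (suc β * Δ))
             (biclique (suc β) Δ W V ^ a * biclique a (suc β) V U ^ (β * Δ)))
    (m∸n+n≡m a≤Δ) (Local.local W V a (Δ ∸ a) β (λ f → total (λ z → U z * avoids f z)) a>0)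

  ∑-wt-1 : ∀ a k (V : Fin q → ℕ) → ∑ (allMaps a q) (λ f → wt V f * 1 ^ k) ≡ total V ^ a
  ∑-wt-1 a k V = trans (∑-cong (allMaps a q) (λ f → trans (cong (wt V f *_) (^-zeroˡ k)) (*-identityʳ _))) (sym (total-^ a V))

  -- `Local` with a = Δ, e = 0 and K = 1, where S and Q are Δ-th powers, so that a Δ-th root can be
  -- taken. It serves the factors |U∖x| coming from triangles and the neighbours of w of degree 1.
  total-bound : ∀ (W V : Fin q → ℕ) Δ β → 0 < Δ → let b = suc β in
    GibbsBound (allFin q) b (λ x → W x ^ b * total (V ∖ x) ^ (b * Δ)) (biclique b Δ W V * total V ^ (β * Δ))
  total-bound W V Δ β Δ>0 = gibbs-root Δ Δ>0 (gibbs-resp (*-comm Δ b)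
    (λ x → trans (cong (λ z → W x ^ (Δ * b) * z ^ (b * Δ)) (∑-wt-1 Δ β (V ∖ x))) (eq₁ (W x) (total (V ∖ x))))
    (trans (cong (λ z → biclique b Δ W V ^ Δ * z ^ (β * Δ)) (∑-wt-1 Δ b V)) (eq₂ (biclique b Δ W V) (total V)))
    (Local.local W V Δ 0 β (λ _ → 1) Δ>0))
    where
    b = suc β
    eq₁ : ∀ w s → w ^ (Δ * b) * (s ^ Δ) ^ (b * Δ) ≡ (w ^ b * s ^ (b * Δ)) ^ Δ
    eq₁ w s = monomial-≡ (w ∷ s ∷ []) (Δ ∷ b ∷ []) (v0 ↑ (x0 :* x1) ⊗ (v1 ↑ x0) ↑ (x1 :* x0)) ((v0 ↑ x1 ⊗ v1 ↑ (x1 :* x0)) ↑ x0) refl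
    eq₂ : ∀ n s → n ^ Δ * (s ^ Δ) ^ (β * Δ) ≡ (n * s ^ (β * Δ)) ^ Δ
    eq₂ n s = monomial-≡ (n ∷ s ∷ []) (Δ ∷ β ∷ []) (v0 ↑ x0 ⊗ (v1 ↑ x0) ↑ (x1 :* x0)) ((v0 ⊗ v1 ↑ (x1 :* x0)) ↑ x0) refl

  avoids≤1 : ∀ {a} (f : Fin a → Fin q) x → avoids f x ≤ 1
  avoids≤1 {a} f x = ≤-trans (∏-mono (allFin a) (λ i → ne≤1 (f i) x)) (≤-reflexive (∏-1 (allFin a)))

  open ≤-Reasoning

  -- Colours y ≠ x on one side never conflict with x, so enlarging the list U ∖ x by x raises the proportion of usable colours.
  enlarge-list : ∀ (U : Fin q → ℕ) x {a} (f : Fin a → Fin q) β →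
    avoids f x * (total (λ z → (U ∖ x) z * avoids f z) ^ β * total U ^ β) ≤
    avoids f x * (total (λ z → U z * avoids f z) ^ β * total (U ∖ x) ^ β)
  enlarge-list U x f β = go (avoids f x) refl (avoids≤1 f x)
    where
    C = total (λ z → (U ∖ x) z * avoids f z)
    T = total (U ∖ x)
    C≤T : C ≤ T
    C≤T = ∑-mono (allFin q) (λ z → ≤-trans (*-monoʳ-≤ ((U ∖ x) z) (avoids≤1 f z)) (≤-reflexive (*-identityʳ _)))
    go : ∀ k → avoids f x ≡ k → k ≤ 1 → k * (C ^ β * total U ^ β) ≤ k * (total (λ z → U z * avoids f z) ^ β * T ^ β)
    go zero    e h = z≤n
    go (suc (suc _)) e (s≤s ())
    -- As `f` avoids x, its usable weight in U is C + U x, and C ≤ T gives C (T + U x) ≤ (C + U x)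
    -- T.
    go 1       e h = *-monoʳ-≤ 1 (begin
      C ^ β * total U ^ β             ≡⟨ ^-distribʳ-* C (total U) β ⟨
      (C * total U) ^ β               ≡⟨ cong (λ z → (C * z) ^ β) (∑-split U x) ⟩
      (C * (T + U x)) ^ β             ≤⟨ ^-monoˡ-≤ β (≤-trans (≤-reflexive (*-distribˡ-+ C T (U x)))
                                           (≤-trans (+-monoʳ-≤ (C * T) (≤-trans (*-monoˡ-≤ (U x) C≤T) (≤-reflexive (*-comm T (U x)))))
                                             (≤-reflexive (sym (*-distribʳ-+ T C (U x)))))) ⟩
      ((C + U x) * T) ^ β             ≡⟨ cong (λ z → (z * T) ^ β) (trans (cong₂ _+_ (∑-cong (allFin q) (λ z → eq (U z) (ne x z) (avoids f z)))
                                           (sym (trans (cong (U x *_) e) (*-identityʳ (U x))))) (sym (∑-split (λ z → U z * avoids f z) x))) ⟩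
      (total (λ z → U z * avoids f z) * T) ^ β ≡⟨ ^-distribʳ-* _ T β ⟩
      total (λ z → U z * avoids f z) ^ β * T ^ β ∎)
      where
      eq : ∀ u n a → u * n * a ≡ u * a * n
      eq = solve-∀

  -- With c = γ + 1 and b - 1 = β this is the triangle inequality in the power γβ(γ+1). `raise` adds
  -- a vertex to the side with list V∖x, by the power mean inequality for `D` under the weights
  -- `wt U′`; `enlarge` then returns x to the list of the other side.
  triangle : ∀ (V U : Fin q → ℕ) x γ β → biclique γ β (V ∖ x) (U ∖ x) ^ suc γ * total U ^ (γ * β) ≤
             biclique (suc γ) β (V ∖ x) U ^ γ * total (U ∖ x) ^ (β * suc γ)
  triangle V U x γ β = begin
    biclique γ β V′ U′ ^ suc γ * total U ^ (γ * β)
      ≤⟨ *-monoˡ-≤ (total U ^ (γ * β)) raise ⟩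
    T ^ β * N′ ^ γ * total U ^ (γ * β)
      ≡⟨ monomial-≡ (T ∷ N′ ∷ total U ∷ []) (γ ∷ β ∷ []) (v0 ↑ x1 ⊗ v1 ↑ x0 ⊗ v2 ↑ (x0 :* x1)) (v0 ↑ x1 ⊗ (v1 ⊗ v2 ↑ x1) ↑ x0) refl ⟩
    T ^ β * (N′ * total U ^ β) ^ γ
      ≤⟨ *-monoʳ-≤ (T ^ β) (^-monoˡ-≤ γ enlarge) ⟩
    T ^ β * (N * T ^ β) ^ γ
      ≡⟨ monomial-≡ (T ∷ N ∷ []) (γ ∷ β ∷ []) (v0 ↑ x1 ⊗ (v1 ⊗ v0 ↑ x1) ↑ x0) (v1 ↑ x0 ⊗ v0 ↑ (x1 :* (con 1 :+ x0))) refl ⟩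
    N ^ γ * T ^ (β * suc γ) ∎
    where
    V′ = V ∖ x
    U′ = U ∖ x
    T = total U′
    N = biclique (suc γ) β V′ U
    N′ = biclique (suc γ) β V′ U′
    D : (Fin β → Fin q) → ℕ
    D g = total (λ z → V′ z * avoids g z)
    raise : biclique γ β V′ U′ ^ suc γ ≤ T ^ β * N′ ^ γ
    raise = subst₂ _≤_
      (cong (_^ suc γ) (trans (∑-cong (allMaps β q) (λ g → cong (wt U′ g *_) (+-identityʳ (D g ^ γ)))) (biclique-comm β γ U′ V′)))
      (cong₂ _*_ (trans (^-identityʳ _) (∑-wt-1 β (suc γ) U′)) (cong (_^ γ) (biclique-comm β (suc γ) U′ V′)))
      (hölder (allMaps β q) (wt U′) (λ _ → 1) D 1 γ (s≤s z≤n))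
    enlarge : N′ * total U ^ β ≤ N * T ^ β
    enlarge = begin
      N′ * total U ^ β ≡⟨ ∑-*ʳ (allMaps (suc γ) q) (total U ^ β) _ ⟨
      ∑ (allMaps (suc γ) q) (λ f → wt V′ f * total (λ z → U′ z * avoids f z) ^ β * total U ^ β)
        ≡⟨ ∑-cong (allMaps (suc γ) q) (λ f → trans (cong (λ w → w * total (λ z → U′ z * avoids f z) ^ β * total U ^ β) (wt-∖ V x f))
             (eq₂ (wt V f) (avoids f x) _ (total U ^ β))) ⟩
      ∑ (allMaps (suc γ) q) (λ f → wt V f * (avoids f x * (total (λ z → U′ z * avoids f z) ^ β * total U ^ β)))
        ≤⟨ ∑-mono (allMaps (suc γ) q) (λ f → *-monoʳ-≤ (wt V f) (enlarge-list U x f β)) ⟩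
      ∑ (allMaps (suc γ) q) (λ f → wt V f * (avoids f x * (total (λ z → U z * avoids f z) ^ β * T ^ β)))
        ≡⟨ ∑-cong (allMaps (suc γ) q) (λ f → trans (cong (λ w → w * total (λ z → U z * avoids f z) ^ β * T ^ β) (wt-∖ V x f))
             (eq₂ (wt V f) (avoids f x) _ (T ^ β))) ⟨
      ∑ (allMaps (suc γ) q) (λ f → wt V′ f * total (λ z → U z * avoids f z) ^ β * T ^ β)
        ≡⟨ ∑-*ʳ (allMaps (suc γ) q) (T ^ β) _ ⟩
      N * T ^ β ∎
      where
      eq₂ : ∀ v a c d → v * a * c * d ≡ v * (a * (c * d))
      eq₂ = solve-∀

-- Graphs with weighted lists

infixl 5 _when_
_when_ : ℕ → Bool → ℕ
x when false = 1
x when true  = x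

when-* : ∀ x y b → (x * y when b) ≡ (x when b) * (y when b)
when-* x y false = refl
when-* x y true  = refl

when-^ : ∀ x k b → (x ^ k when b) ≡ (x when b) ^ k
when-^ x k false = sym (^-zeroˡ k)
when-^ x k true  = refl

when-bit : ∀ x k b → (x ^ k when b) ≡ x ^ (bit b * k)
when-bit x k false = refl
when-bit x k true  = cong (x ^_) (sym (+-identityʳ k))

∏-delta : ∀ n (R : Fin n → ℕ) w → ∏ (allFin n) (λ v → R v when ⌊ v ≟ w ⌋) ≡ R w
∏-delta (suc n) R zero    = trans (∏-allFin-suc n (λ v → R v when ⌊ v ≟ zero ⌋)) (trans (cong (R zero *_) (∏-1 (allFin n))) (*-identityʳ (R zero)))
∏-delta (suc n) R (suc w) = trans (∏-allFin-suc n (λ v → R v when ⌊ v ≟ suc w ⌋)) (trans (+-identityʳ _)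
  (trans (∏-cong (allFin n) (λ v → cong (R (suc v) when_) (same v))) (∏-delta n (R ∘ suc) w)))
  where
  same : ∀ v → ⌊ suc v ≟ suc w ⌋ ≡ ⌊ v ≟ w ⌋
  same v with v ≟ w
  ... | yes _ = refl
  ... | no  _ = refl

degree : ∀ {n} → Graph n → Fin n → ℕ
degree {n} G v = ∑ (allFin n) (λ u → bit (Adj G v u))

bit≤1 : ∀ b → bit b ≤ 1
bit≤1 false = z≤n
bit≤1 true  = ≤-refl

∑-allFin-1 : ∀ n → ∑ (allFin n) (λ _ → 1) ≡ n
∑-allFin-1 zero    = refl
∑-allFin-1 (suc n) = trans (∑-allFin-suc n (λ _ → 1)) (cong suc (∑-allFin-1 n))

degree≤n : ∀ {n} (G : Graph n) v → degree G v ≤ n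
degree≤n {n} G v = ≤-trans (∑-mono (allFin n) (λ u → bit≤1 (Adj G v u))) (≤-reflexive (∑-allFin-1 n))

adj⇒degree>0 : ∀ {n} (G : Graph n) v u → Adj G v u ≡ true → 0 < degree G v
adj⇒degree>0 {n} G v u e = ≤-trans (≤-reflexive (cong bit (sym e))) (∑-allFin-≥ n (λ u → bit (Adj G v u)) u)

isolate : ∀ {n} → Graph n → Fin n → Graph n
isolate G w = record
  { Adj    = λ v u → Adj G v u ∧ (not ⌊ v ≟ w ⌋ ∧ not ⌊ u ≟ w ⌋)
  ; sym    = λ v u → cong₂ _∧_ (Graph.sym G v u) (∧-comm (not ⌊ v ≟ w ⌋) _)
  ; irrefl = λ v → cong (_∧ (not ⌊ v ≟ w ⌋ ∧ not ⌊ v ≟ w ⌋)) (irrefl G v)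
  }

isolate-adj : ∀ {n} (G : Graph n) w v u → Adj (isolate G w) v u ≡ true → Adj G v u ≡ true × v ≢ w × u ≢ w
isolate-adj G w v u e with Adj G v u | v ≟ w | u ≟ w
... | true | no ¬p | no ¬q = refl , ¬p , ¬q

isolate-degree-self : ∀ {n} (G : Graph n) w → degree (isolate G w) w ≡ 0
isolate-degree-self {n} G w = trans (∑-cong (allFin n) zero-bit) (∑-0 (allFin n))
  where
  zero-bit : ∀ u → bit (Adj G w u ∧ (not ⌊ w ≟ w ⌋ ∧ not ⌊ u ≟ w ⌋)) ≡ 0
  zero-bit u with Adj G w u | w ≟ w
  ... | false | _       = refl
  ... | true  | yes _   = refl
  ... | true  | no ¬p   = ⊥-elim (¬p refl)

isolate-degree : ∀ {n} (G : Graph n) w v → v ≢ w → degree G v ≡ degree (isolate G w) v + bit (Adj G w v)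
isolate-degree {n} G w v v≢w = trans (∑-split (λ u → bit (Adj G v u)) w)
  (cong₂ _+_ (∑-cong (allFin n) same) (cong bit (Graph.sym G v w)))
  where
  same : ∀ u → bit (Adj G v u) * ne w u ≡ bit (Adj G v u ∧ (not ⌊ v ≟ w ⌋ ∧ not ⌊ u ≟ w ⌋))
  same u with Adj G v u | v ≟ w | w ≟ u | u ≟ w
  ... | _     | yes p | _     | _     = ⊥-elim (v≢w p)
  ... | false | no _  | _     | _     = refl
  ... | true  | no _  | yes _ | yes _ = refl
  ... | true  | no _  | no _  | no _  = refl
  ... | true  | no _  | yes p | no ¬q = ⊥-elim (¬q (sym p))
  ... | true  | no _  | no ¬p | yes q = ⊥-elim (¬p (sym q))

δ : ∀ {q} → Fin q → Fin q → ℕ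
δ x y = bit ⌊ y ≟ x ⌋

δ-self : ∀ {q} (x : Fin q) → δ x x ≡ 1
δ-self x with x ≟ x
... | yes _ = refl
... | no ¬p = ⊥-elim (¬p refl)

total-δ : ∀ {q} (x : Fin q) → total (δ x) ≡ 1
total-δ {q} x = trans (∑-split (δ x) x) (cong₂ _+_ (trans (∑-cong (allFin q) vanish) (∑-0 (allFin q))) (δ-self x))
  where
  vanish : ∀ y → δ x y * ne x y ≡ 0
  vanish y with y ≟ x | x ≟ y
  ... | no _  | _     = refl
  ... | yes _ | yes _ = refl
  ... | yes p | no ¬q = ⊥-elim (¬q (sym p))

module _ {n q : ℕ} where

  Lists : Set
  Lists = Fin n → Fin q → ℕ

  edgeFactor : Graph n → (Fin n → Fin q) → Fin n → Fin n → ℕ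
  edgeFactor G f u v = bit (not (Adj G u v) ∨ not ⌊ f u ≟ f v ⌋)

  weight : Graph n → Lists → (Fin n → Fin q) → ℕ
  weight G L f = ∏ (allFin n) (λ v → L v (f v)) * ∏ (allFin n) (λ u → ∏ (allFin n) (edgeFactor G f u))

  partition : Graph n → Lists → ℕ
  partition G L = ∑ (allMaps n q) (weight G L)

  -- The list `δ x` has total 1, so `w`, which is isolated from now on, contributes a factor 1 to
  -- the bound.
  assign : Graph n → Fin n → Fin q → Lists → Lists
  assign G w x L v = if ⌊ v ≟ w ⌋ then δ x else if Adj G w v then L v ∖ x else L v

  assign-self : ∀ G w x L → assign G w x L w ≡ δ x
  assign-self G w x L with w ≟ w
  ... | yes _ = refl
  ... | no ¬p = ⊥-elim (¬p refl)

  assign-near : ∀ G w x L v → v ≢ w → Adj G w v ≡ true → assign G w x L v ≡ L v ∖ x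
  assign-near G w x L v v≢w e with v ≟ w
  ... | yes p = ⊥-elim (v≢w p)
  ... | no _ rewrite e = refl

  assign-far : ∀ G w x L v → v ≢ w → Adj G w v ≡ false → assign G w x L v ≡ L v
  assign-far G w x L v v≢w e with v ≟ w
  ... | yes p = ⊥-elim (v≢w p)
  ... | no _ rewrite e = refl

  open ≤-Reasoning

  -- The row of `w` in the edge product is distributed over the vertices: at a neighbour v it says
  -- that f v differs from f w, which is what `∖` puts into the list. The column of `w` repeats the
  -- row and is bounded by 1.
  weight-isolate : ∀ G L w f → weight G L f ≤ L w (f w) * weight (isolate G w) (assign G w (f w) L) f
  weight-isolate G L w f = begin
    ∏ (allFin n) (λ v → L v (f v)) * ∏ (allFin n) (λ u → ∏ (allFin n) (edgeFactor G f u))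
      ≤⟨ *-monoʳ-≤ (∏ (allFin n) (λ v → L v (f v))) (∏-mono (allFin n) rows) ⟩
    ∏ (allFin n) (λ v → L v (f v)) * ∏ (allFin n) (λ u → (R when ⌊ u ≟ w ⌋) * ∏ (allFin n) (edgeFactor (isolate G w) f u))
      ≡⟨ cong (∏ (allFin n) (λ v → L v (f v)) *_) (trans (∏-* (allFin n) _ _) (cong (_* P) (∏-delta n (λ _ → R) w))) ⟩
    ∏ (allFin n) (λ v → L v (f v)) * (R * P)
      ≡⟨ *-assoc (∏ (allFin n) (λ v → L v (f v))) R P ⟨
    ∏ (allFin n) (λ v → L v (f v)) * R * P
      ≡⟨ cong (_* P) (∏-* (allFin n) _ _) ⟨
    ∏ (allFin n) (λ v → L v (f v) * edgeFactor G f w v) * P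
      ≤⟨ *-monoˡ-≤ P (∏-mono (allFin n) vertices) ⟩
    ∏ (allFin n) (λ v → (L w (f w) when ⌊ v ≟ w ⌋) * assign G w (f w) L v (f v)) * P
      ≡⟨ cong (_* P) (trans (∏-* (allFin n) _ _) (cong (_* ∏ (allFin n) (λ v → assign G w (f w) L v (f v))) (∏-delta n (λ _ → L w (f w)) w))) ⟩
    L w (f w) * ∏ (allFin n) (λ v → assign G w (f w) L v (f v)) * P
      ≡⟨ *-assoc (L w (f w)) _ P ⟩
    L w (f w) * weight (isolate G w) (assign G w (f w) L) f ∎
    where
    R = ∏ (allFin n) (edgeFactor G f w)
    P = ∏ (allFin n) (λ u → ∏ (allFin n) (edgeFactor (isolate G w) f u))
    at-w : ∀ v → edgeFactor (isolate G w) f w v ≡ 1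
    at-w v with Adj G w v | w ≟ w
    ... | false | _     = refl
    ... | true  | yes _ = refl
    ... | true  | no ¬p = ⊥-elim (¬p refl)
    fewer : ∀ u v → edgeFactor G f u v ≤ edgeFactor (isolate G w) f u v
    fewer u v with Adj G u v | not ⌊ u ≟ w ⌋ ∧ not ⌊ v ≟ w ⌋
    ... | false | _     = ≤-refl
    ... | true  | true  = ≤-refl
    ... | true  | false = bit≤1 _
    rows : ∀ u → ∏ (allFin n) (edgeFactor G f u) ≤ (R when ⌊ u ≟ w ⌋) * ∏ (allFin n) (edgeFactor (isolate G w) f u)
    rows u = go (u ≟ w)
      where
      go : (d : Dec (u ≡ w)) → ∏ (allFin n) (edgeFactor G f u) ≤ (R when ⌊ d ⌋) * ∏ (allFin n) (edgeFactor (isolate G w) f u)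
      go (yes refl) = ≤-reflexive (sym (trans (cong (R *_) (trans (∏-cong (allFin n) at-w) (∏-1 (allFin n)))) (*-identityʳ R)))
      go (no _)     = ≤-trans (∏-mono (allFin n) (fewer u)) (≤-reflexive (sym (+-identityʳ _)))
    vertices : ∀ v → L v (f v) * edgeFactor G f w v ≤ (L w (f w) when ⌊ v ≟ w ⌋) * assign G w (f w) L v (f v)
    vertices v with v ≟ w
    ... | yes refl = *-monoʳ-≤ (L v (f v)) (≤-trans (bit≤1 _) (≤-reflexive (sym (δ-self (f v)))))
    ... | no _ with Adj G w v
    ...   | true  = ≤-reflexive (sym (+-identityʳ _))
    ...   | false = ≤-reflexive (trans (*-identityʳ _) (sym (+-identityʳ _)))

  -- The colour f w becomes a free variable x: the sum over all x contains the term x = f w, and an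
  -- upper bound is all that the induction asks for.
  partition-isolate : ∀ G L w → partition G L ≤ total (λ x → L w x * partition (isolate G w) (assign G w x L))
  partition-isolate G L w = begin
    ∑ (allMaps n q) (weight G L)
      ≤⟨ ∑-mono (allMaps n q) (λ f → ≤-trans (weight-isolate G L w f)
           (∑-allFin-≥ q (λ x → L w x * weight (isolate G w) (assign G w x L) f) (f w))) ⟩
    ∑ (allMaps n q) (λ f → total (λ x → L w x * weight (isolate G w) (assign G w x L) f))
      ≡⟨ ∑-swap (allMaps n q) (allFin q) _ ⟩
    total (λ x → ∑ (allMaps n q) (λ f → L w x * weight (isolate G w) (assign G w x L) f))
      ≡⟨ ∑-cong (allFin q) (λ x → ∑-*ˡ (allMaps n q) (L w x) _) ⟩
    total (λ x → L w x * partition (isolate G w) (assign G w x L)) ∎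

  partition≤∏-total : ∀ G L → partition G L ≤ ∏ (allFin n) (λ v → total (L v))
  partition≤∏-total G L = ≤-trans
    (∑-mono (allMaps n q) (λ f → ≤-trans (*-monoʳ-≤ (∏ (allFin n) (λ v → L v (f v))) (≤-trans
      (∏-mono (allFin n) (λ u → ≤-trans (∏-mono (allFin n) (λ v → bit≤1 _)) (≤-reflexive (∏-1 (allFin n))))) (≤-reflexive (∏-1 (allFin n)))))
      (≤-reflexive (*-identityʳ _))))
    (≤-reflexive (∑-∏ n q L))

-- Gibbs bounds weighted by the list of the removed vertex

∏-when-const : ∀ {A : Set} (xs : List A) x k (p : A → Bool) → ∏ xs (λ v → x ^ k when p v) ≡ x ^ (∑ xs (λ v → bit (p v)) * k)
∏-when-const xs x k p = trans (∏-cong xs (λ v → when-bit x k (p v))) (trans (∏-base^ xs x _) (cong (x ^_) (∑-*ʳ xs k _)))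

-- It expresses ∑ W φ^(1/s) ≤ Y^(1/s). Tying the exponent of W to s makes W occur exactly once in
-- the sum, however many factors are multiplied.
WeightedGibbs : ∀ {q} → (Fin q → ℕ) → ℕ → (Fin q → ℕ) → ℕ → Set
WeightedGibbs {q} W s φ Y = GibbsBound (allFin q) s (λ x → W x ^ s * φ x) Y

module _ {q : ℕ} {W : Fin q → ℕ} where

  wg-resp : ∀ {s t φ ψ Y Z} → s ≡ t → (∀ x → φ x ≡ ψ x) → Y ≡ Z → WeightedGibbs W s φ Y → WeightedGibbs W t ψ Z
  wg-resp {s} refl h refl = gibbs-resp refl (λ x → cong (W x ^ s *_) (h x)) refl

  wg-* : ∀ {s t φ ψ Y Z} → WeightedGibbs W s φ Y → WeightedGibbs W t ψ Z → WeightedGibbs W (s + t) (λ x → φ x * ψ x) (Y * Z)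
  wg-* {s} {t} {φ} {ψ} g h = gibbs-resp refl (λ x → trans ([m*n]*[o*p]≡[m*o]*[n*p] (W x ^ s) (φ x) (W x ^ t) (ψ x))
    (cong (_* (φ x * ψ x)) (sym (^-distribˡ-+-* (W x) s t)))) refl (gibbs-* g h)

  wg-1 : WeightedGibbs W 0 (λ _ → 1) 1
  wg-1 = gibbs-const (allFin q) 1

  wg-when : ∀ {s φ Y} b → (b ≡ true → WeightedGibbs W s φ Y) → WeightedGibbs W (bit b * s) (λ x → φ x when b) (Y when b)
  wg-when false g = wg-1
  wg-when true  g = wg-resp (sym (+-identityʳ _)) (λ _ → refl) refl (g refl)

  wg-∏ : ∀ {B : Set} (vs : List B) {s : B → ℕ} {φ : B → Fin q → ℕ} {Y : B → ℕ} →
         (∀ v → WeightedGibbs W (s v) (φ v) (Y v)) → WeightedGibbs W (∑ vs s) (λ x → ∏ vs (λ v → φ v x)) (∏ vs Y)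
  wg-∏ []       h = wg-1
  wg-∏ (v ∷ vs) h = wg-* (h v) (wg-∏ vs h)

  wg-root : ∀ {s φ Y} k → 0 < k → WeightedGibbs W (s * k) (λ x → φ x ^ k) (Y ^ k) → WeightedGibbs W s φ Y
  wg-root {s} {φ} k k>0 g = gibbs-root k k>0 (gibbs-resp refl (λ x → trans (cong (_* φ x ^ k) (sym (^-*-assoc (W x) s k)))
    (sym (^-distribʳ-* (W x ^ s) (φ x) k))) refl g)

  wg⇒∑-bound : ∀ {s φ Y} → WeightedGibbs W s φ Y → 0 < s → ∀ κ κ′ (p : Fin q → ℕ) →
               (∀ x → κ * p x ^ s ≤ κ′ * φ x) → κ * total (λ x → W x * p x) ^ s ≤ κ′ * Y
  wg⇒∑-bound {s} {φ} g s>0 κ κ′ p h = gibbs⇒∑-bound g s>0 κ κ′ _ (λ x → begin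
    κ * (W x * p x) ^ s       ≡⟨ cong (κ *_) (^-distribʳ-* (W x) (p x) s) ⟩
    κ * (W x ^ s * p x ^ s)   ≡⟨ eq κ (W x ^ s) (p x ^ s) ⟩
    W x ^ s * (κ * p x ^ s)   ≤⟨ *-monoʳ-≤ (W x ^ s) (h x) ⟩
    W x ^ s * (κ′ * φ x)      ≡⟨ eq (W x ^ s) κ′ (φ x) ⟩
    κ′ * (W x ^ s * φ x)      ∎)
    where
    open ≤-Reasoning
    eq : ∀ a b c → a * (b * c) ≡ b * (a * c)
    eq = solve-∀

-- The integer r d stands for F / d, so that the exponent 1 / (d_u d_v) becomes r d_u * r d_v after raising to the power F².
module Normalised (F : ℕ) (r : ℕ → ℕ) where

  module _ {q : ℕ} (W V : Fin q → ℕ) where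

    -- In the power r a · r b · r β of `edge-bound` the Gibbs exponent F² r β no longer depends on
    -- a: all β remaining edges of v claim the same share, together F³.
    scaled-edge-bound : ∀ U {a b Δ} β → b ≡ suc β → r a * a ≡ F → r b * b ≡ F → r β * β ≡ F → 0 < a → a ≤ Δ →
      WeightedGibbs W (F * F * r β) (λ x → (biclique a β (V ∖ x) U ^ (r a * r β)) ^ (F * Δ))
        (biclique b Δ W V ^ (F * (r b * r β)) * (biclique a b V U ^ (r a * r b)) ^ (F * Δ))
    scaled-edge-bound U {a} {b} {Δ} β refl ra rb rβ a>0 a≤Δ = gibbs-resp s-eq
      (λ x → trans (monomial-≡ (W x ∷ S x ∷ []) (a * b ∷ b * Δ ∷ k ∷ [])
                      ((v0 ↑ x0 ⊗ v1 ↑ x1) ↑ x2) (v0 ↑ (x0 :* x2) ⊗ v1 ↑ (x1 :* x2)) refl)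
              (cong₂ (λ i j → W x ^ i * j) s-eq (trans (cong (S x ^_) S-eq) (sym (^-*-assoc (S x) (r a * r β) (F * Δ))))))
      (trans (monomial-≡ (N ∷ Q ∷ []) (a ∷ β * Δ ∷ k ∷ [])
                      ((v0 ↑ x0 ⊗ v1 ↑ x1) ↑ x2) (v0 ↑ (x0 :* x2) ⊗ v1 ↑ (x1 :* x2)) refl)
              (cong₂ _*_ (cong (N ^_) N-eq) (trans (cong (Q ^_) Q-eq) (sym (^-*-assoc Q (r a * r b) (F * Δ))))))
      (gibbs-^ k (edge-bound W V U β a>0 a≤Δ))
      where
      k = r a * r b * r β
      N = biclique b Δ W V
      Q = biclique a b V U
      S : Fin q → ℕ
      S x = biclique a β (V ∖ x) U
      s-eq : a * b * k ≡ F * F * r β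
      s-eq = trans (eq a b (r a) (r b) (r β)) (cong₂ (λ i j → i * j * r β) ra rb)
        where eq : ∀ a b x y z → a * b * (x * y * z) ≡ (x * a) * (y * b) * z
              eq = solve-∀
      S-eq : b * Δ * k ≡ r a * r β * (F * Δ)
      S-eq = trans (eq b Δ (r a) (r b) (r β)) (cong (λ i → r a * r β * (i * Δ)) rb)
        where eq : ∀ b D x y z → b * D * (x * y * z) ≡ x * z * (y * b * D)
              eq = solve-∀
      N-eq : a * k ≡ F * (r b * r β)
      N-eq = trans (eq a (r a) (r b) (r β)) (cong (λ i → i * (r b * r β)) ra)
        where eq : ∀ a x y z → a * (x * y * z) ≡ x * a * (y * z)
              eq = solve-∀
      Q-eq : β * Δ * k ≡ r a * r b * (F * Δ)
      Q-eq = trans (eq β Δ (r a) (r b) (r β)) (cong (λ i → r a * r b * (i * Δ)) rβ)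
        where eq : ∀ B D x y z → B * D * (x * y * z) ≡ x * y * (z * B * D)
              eq = solve-∀

    -- The power is chosen to reproduce the Gibbs exponent F² r β and the power of N from
    -- `scaled-edge-bound`, so that triangle factors take the same share as ordinary edges.
    scaled-total-bound : ∀ {b Δ} β → b ≡ suc β → r b * b ≡ F → r β * β ≡ F → 0 < Δ →
      WeightedGibbs W (F * F * r β) (λ x → (total (V ∖ x) ^ (r β * F)) ^ (F * Δ))
        (biclique b Δ W V ^ (F * (r b * r β)) * (total V ^ (r b * F)) ^ (F * Δ))
    scaled-total-bound {b} {Δ} β refl rb rβ Δ>0 = gibbs-resp s-eq
      (λ x → trans (monomial-≡ (W x ∷ total (V ∖ x) ∷ []) (b ∷ b * Δ ∷ k ∷ [])
                      ((v0 ↑ x0 ⊗ v1 ↑ x1) ↑ x2) (v0 ↑ (x0 :* x2) ⊗ v1 ↑ (x1 :* x2)) refl)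
              (cong₂ (λ i j → W x ^ i * j) s-eq (trans (cong (total (V ∖ x) ^_) T-eq) (sym (^-*-assoc (total (V ∖ x)) (r β * F) (F * Δ))))))
      (trans (monomial-≡ (N ∷ total V ∷ []) (β * Δ ∷ k ∷ [])
                      ((v0 ⊗ v1 ↑ x0) ↑ x1) (v0 ↑ x1 ⊗ v1 ↑ (x0 :* x1)) refl)
              (cong₂ _*_ (cong (N ^_) N-eq) (trans (cong (total V ^_) Q-eq) (sym (^-*-assoc (total V) (r b * F) (F * Δ))))))
      (gibbs-^ k (total-bound W V Δ β Δ>0))
      where
      k = r b * r β * F
      N = biclique b Δ W V
      s-eq : b * k ≡ F * F * r β
      s-eq = trans (eq b (r b) (r β) F) (cong (λ i → i * F * r β) rb)
        where eq : ∀ b y z f → b * (y * z * f) ≡ (y * b) * f * z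
              eq = solve-∀
      T-eq : b * Δ * k ≡ r β * F * (F * Δ)
      T-eq = trans (eq b Δ (r b) (r β) F) (cong (λ i → r β * F * (i * Δ)) rb)
        where eq : ∀ b D y z f → b * D * (y * z * f) ≡ z * f * (y * b * D)
              eq = solve-∀
      N-eq : k ≡ F * (r b * r β)
      N-eq = *-comm (r b * r β) F
      Q-eq : β * Δ * k ≡ r b * F * (F * Δ)
      Q-eq = trans (eq β Δ (r b) (r β) F) (cong (λ i → r b * F * (i * Δ)) rβ)
        where eq : ∀ B D y z f → B * D * (y * z * f) ≡ y * f * (z * B * D)
              eq = solve-∀

    -- A neighbour of degree 1 has no further edges among which to split its share 2F³, so the
    -- factor of the newly isolated vertex takes all of it.
    scaled-isolated-bound : ∀ {b Δ} → b ≡ 1 → r b * b ≡ F → 0 < Δ →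
      WeightedGibbs W (2 * (F * F) * F) (λ x → (total (V ∖ x) ^ (2 * (F * F))) ^ (F * Δ)) (biclique b Δ W V ^ (2 * (F * F) * r b))
    scaled-isolated-bound {Δ = Δ} refl rb Δ>0 = gibbs-resp s-eq
      (λ x → trans (monomial-≡ (W x ∷ total (V ∖ x) ∷ []) (Δ ∷ F ∷ [])
                      ((v0 ↑ con 1 ⊗ v1 ↑ (con 1 :* x0)) ↑ (con 2 :* (x1 :* x1) :* x1)) (v0 ↑ (con 1 :* (con 2 :* (x1 :* x1) :* x1)) ⊗ (v1 ↑ (con 2 :* (x1 :* x1))) ↑ (x1 :* x0)) refl)
              (cong (λ i → W x ^ i * (total (V ∖ x) ^ (2 * (F * F))) ^ (F * Δ)) s-eq))
      (trans (cong (_^ (2 * (F * F) * F)) (*-identityʳ (biclique 1 Δ W V)))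
        (cong (λ i → biclique 1 Δ W V ^ (2 * (F * F) * i)) (trans (sym rb) (*-identityʳ (r 1)))))
      (gibbs-^ (2 * (F * F) * F) (total-bound W V Δ 0 Δ>0))
      where
      s-eq : 1 * (2 * (F * F) * F) ≡ 2 * (F * F) * F
      s-eq = *-identityˡ _

  scaled-triangle : ∀ {q} (V U : Fin q → ℕ) x {c} γ β → c ≡ suc γ → r c * c ≡ F → r γ * γ ≡ F → r β * β ≡ F →
    biclique γ β (V ∖ x) (U ∖ x) ^ (r β * r γ) * total U ^ (r c * F) ≤
    biclique c β (V ∖ x) U ^ (r c * r β) * total (U ∖ x) ^ (r γ * F)
  scaled-triangle V U x {c} γ β refl rc rγ rβ = ^-cancelˡ-≤ c (s≤s z≤n) (begin
    (n₁ ^ (r β * r γ) * total U ^ (r c * F)) ^ c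
      ≡⟨ monomial-≡ (n₁ ∷ total U ∷ []) (r β * r γ ∷ r c * F ∷ c ∷ []) ((v0 ↑ x0 ⊗ v1 ↑ x1) ↑ x2) (v0 ↑ (x2 :* x0) ⊗ v1 ↑ (x1 :* x2)) refl ⟩
    n₁ ^ (c * (r β * r γ)) * total U ^ (r c * F * c)
      ≡⟨ cong₂ (λ i j → i * total U ^ j) (sym (^-*-assoc n₁ c (r β * r γ))) eq₁ ⟩
    (n₁ ^ c) ^ (r β * r γ) * total U ^ (γ * β * (r β * r γ))
      ≡⟨ cong ((n₁ ^ c) ^ (r β * r γ) *_) (sym (^-*-assoc (total U) (γ * β) (r β * r γ))) ⟩
    (n₁ ^ c) ^ (r β * r γ) * (total U ^ (γ * β)) ^ (r β * r γ)
      ≡⟨ ^-distribʳ-* (n₁ ^ c) (total U ^ (γ * β)) (r β * r γ) ⟨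
    (n₁ ^ c * total U ^ (γ * β)) ^ (r β * r γ)
      ≤⟨ ^-monoˡ-≤ (r β * r γ) (triangle V U x γ β) ⟩
    (n₂ ^ γ * total (U ∖ x) ^ (β * c)) ^ (r β * r γ)
      ≡⟨ monomial-≡ (n₂ ∷ total (U ∖ x) ∷ []) (γ ∷ β * c ∷ r β * r γ ∷ []) ((v0 ↑ x0 ⊗ v1 ↑ x1) ↑ x2) (v0 ↑ (x0 :* x2) ⊗ v1 ↑ (x1 :* x2)) refl ⟩
    n₂ ^ (γ * (r β * r γ)) * total (U ∖ x) ^ (β * c * (r β * r γ))
      ≡⟨ cong₂ (λ i j → n₂ ^ i * total (U ∖ x) ^ j) eq₂ eq₃ ⟩
    n₂ ^ (r c * r β * c) * total (U ∖ x) ^ (r γ * F * c)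
      ≡⟨ monomial-≡ (n₂ ∷ total (U ∖ x) ∷ []) (r c * r β ∷ r γ * F ∷ c ∷ []) (v0 ↑ (x0 :* x2) ⊗ v1 ↑ (x1 :* x2)) ((v0 ↑ x0 ⊗ v1 ↑ x1) ↑ x2) refl ⟩
    (n₂ ^ (r c * r β) * total (U ∖ x) ^ (r γ * F)) ^ c ∎)
    where
    open ≤-Reasoning
    n₁ = biclique γ β (V ∖ x) (U ∖ x)
    n₂ = biclique c β (V ∖ x) U
    eq₁ : r c * F * c ≡ γ * β * (r β * r γ)
    eq₁ = trans (lhs (r c) F c) (trans (cong₂ _*_ (trans rc (sym rγ)) (sym rβ)) (rhs (r γ) γ (r β) β))
      where lhs : ∀ x f c → x * f * c ≡ x * c * f
            lhs = solve-∀
            rhs : ∀ x g y b → x * g * (y * b) ≡ g * b * (y * x)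
            rhs = solve-∀
    eq₂ : γ * (r β * r γ) ≡ r c * r β * c
    eq₂ = trans (lhs γ (r β) (r γ)) (trans (cong (_* r β) (trans rγ (sym rc))) (rhs (r c) c (r β)))
      where lhs : ∀ g y x → g * (y * x) ≡ x * g * y
            lhs = solve-∀
            rhs : ∀ x c y → x * c * y ≡ x * y * c
            rhs = solve-∀
    eq₃ : β * c * (r β * r γ) ≡ r γ * F * c
    eq₃ = trans (lhs β c (r β) (r γ)) (cong (λ i → r γ * i * c) rβ)
      where lhs : ∀ b c y x → b * c * (y * x) ≡ x * (y * b) * c
            lhs = solve-∀

-- Induction on the edges: removing a vertex of maximal degree

isZero : ℕ → Bool
isZero zero    = true
isZero (suc _) = false

∏² : ∀ {n} → (Fin n → Fin n → ℕ) → ℕ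
∏² {n} f = ∏ (allFin n) (λ v → ∏ (allFin n) (f v))

module _ {n : ℕ} where

  ∏²-cong : ∀ {f g : Fin n → Fin n → ℕ} → (∀ v u → f v u ≡ g v u) → ∏² f ≡ ∏² g
  ∏²-cong h = ∏-cong (allFin n) (λ v → ∏-cong (allFin n) (h v))

  ∏²-mono : ∀ {f g : Fin n → Fin n → ℕ} → (∀ v u → f v u ≤ g v u) → ∏² f ≤ ∏² g
  ∏²-mono h = ∏-mono (allFin n) (λ v → ∏-mono (allFin n) (h v))

  ∏²-* : ∀ (f g : Fin n → Fin n → ℕ) → ∏² (λ v u → f v u * g v u) ≡ ∏² f * ∏² g
  ∏²-* f g = trans (∏-cong (allFin n) (λ v → ∏-* (allFin n) (f v) (g v))) (∏-* (allFin n) _ _)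

  ∏²-swap : ∀ (f : Fin n → Fin n → ℕ) → ∏² f ≡ ∏² (λ v u → f u v)
  ∏²-swap f = ∏-swap (allFin n) (allFin n) f

maximum : ∀ n (f : Fin n → ℕ) → (∀ v → f v ≡ 0) ⊎ (∃[ w ] (0 < f w × (∀ v → f v ≤ f w)))
maximum zero    f = inj₁ (λ ())
maximum (suc n) f with maximum n (f ∘ suc) | 1 ≤? f zero
... | inj₁ zeros | no f₀≡0 = inj₁ (λ { zero → n≤0⇒n≡0 (≤-pred (≰⇒> f₀≡0)) ; (suc v) → zeros v })
... | inj₁ zeros | yes f₀>0 = inj₂ (zero , f₀>0 , λ { zero → ≤-refl ; (suc v) → ≤-trans (≤-reflexive (zeros v)) z≤n })
... | inj₂ (w , pos , max) | _ with ≤-total (f zero) (f (suc w))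
...   | inj₁ f₀≤fw = inj₂ (suc w , pos , λ { zero → f₀≤fw ; (suc v) → max v })
...   | inj₂ fw≤f₀ = inj₂ (zero , ≤-trans pos fw≤f₀ , λ { zero → ≤-refl ; (suc v) → ≤-trans (max v) fw≤f₀ })

∏-factor>0 : ∀ n (f : Fin n → ℕ) → 0 < ∏ (allFin n) f → ∀ v → 0 < f v
∏-factor>0 (suc n) f h v with f zero in e | subst (0 <_) (∏-allFin-suc n f) h
∏-factor>0 (suc n) f h zero    | suc k | _  = subst (0 <_) (sym e) (s≤s z≤n)
∏-factor>0 (suc n) f h (suc v) | suc k | h′ = ∏-factor>0 n (f ∘ suc) (positive-factor h′) v
  where
  positive-factor : ∀ {m} → 0 < suc k * m → 0 < m
  positive-factor {zero}  p = subst (0 <_) (*-zeroʳ (suc k)) p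
  positive-factor {suc m} p = s≤s z≤n

module Step (F : ℕ) {n q : ℕ} (r : ℕ → ℕ) (F>0 : 0 < F) (r-inverse : ∀ {d} → 0 < d → d ≤ n → r d * d ≡ F) where

  open Normalised F r

  -- A vertex of degree d_v in K_{d_u,d_v} lies on the side of size d_u; this is why the list of v
  -- goes to the d_u vertices.
  edgeBound : Graph n → Lists {n} {q} → Fin n → Fin n → ℕ
  edgeBound G L v u = biclique (degree G u) (degree G v) (L v) (L u) ^ (r (degree G v) * r (degree G u))

  vertexBound : Graph n → Lists {n} {q} → Fin n → ℕ
  vertexBound G L v = total (L v) ^ (2 * (F * F)) when isZero (degree G v)

  graphBound : Graph n → Lists {n} {q} → ℕ
  graphBound G L = ∏ (allFin n) (vertexBound G L) * ∏² (λ v u → edgeBound G L v u when Adj G v u)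

  module _ (G : Graph n) (L : Lists {n} {q}) (w : Fin n)
           (deg-w>0 : 0 < degree G w) (deg-w-max : ∀ v → degree G v ≤ degree G w) where

    private
      G′ : Graph n
      G′ = isolate G w
      L′ : Fin q → Lists
      L′ x = assign G w x L
      d d⁻ : Fin n → ℕ
      d  v = degree G v
      d⁻ v = pred (d v)
      Δ = d w
      near : Fin n → Bool
      near v = Adj G w v
      inner : Fin n → Fin n → Bool
      inner v u = Adj G′ v u
      N : Fin n → ℕ
      N v = biclique (d v) Δ (L w) (L v)
      E : Fin n → Fin n → ℕ
      E v u = biclique (d u) (d v) (L v) (L u) ^ (r (d u) * r (d v))

      -- An edge vu with v ~ w contributes A twice, or A and B if also u ~ w.  E and B∞ are the corresponding factors of
      -- the bound for G; κ is the denominator |U| ^ (1/c) of the triangle inequality.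
      out : Fin n → Fin n → Bool
      out v u = near v ∧ inner v u
      A B : Fin n → Fin n → Fin q → ℕ
      A v u x = biclique (d u) (d⁻ v) (L v ∖ x) (L u) ^ (r (d u) * r (d⁻ v))
      B v u x = if near u then total (L v ∖ x) ^ (r (d⁻ v) * F) else A v u x
      B∞ : Fin n → Fin n → ℕ
      B∞ v u = if near u then total (L v) ^ (r (d v) * F) else E v u
      κ : Fin n → Fin n → ℕ
      κ v u = total (L v) ^ (r (d v) * F) when out v u ∧ near u
      rest : Fin n → Fin n → ℕ
      rest v u = E v u when inner v u ∧ (not (near v) ∧ not (near u))
      alone : Fin n → Bool
      alone v = near v ∧ isZero (d⁻ v)

      w-not-near : near w ≡ false
      w-not-near = irrefl G w

      near≢w : ∀ v → near v ≡ true → v ≢ w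
      near≢w v e refl with trans (sym e) w-not-near
      ... | ()

      degree-near : ∀ v → near v ≡ true → d v ≡ suc (degree G′ v)
      degree-near v e = trans (isolate-degree G w v (near≢w v e)) (trans (cong (λ b → degree G′ v + bit b) e) (+-comm _ 1))

      degree-near⁻ : ∀ v → near v ≡ true → degree G′ v ≡ d⁻ v
      degree-near⁻ v e = cong pred (sym (degree-near v e))

      degree-near-suc : ∀ v → near v ≡ true → d v ≡ suc (d⁻ v)
      degree-near-suc v e = trans (degree-near v e) (cong suc (degree-near⁻ v e))

      degree-far : ∀ v → v ≢ w → near v ≡ false → degree G′ v ≡ d v
      degree-far v v≢w e = sym (trans (isolate-degree G w v v≢w) (trans (cong (λ b → degree G′ v + bit b) e) (+-identityʳ _)))

      r-d : ∀ v → 0 < d v → r (d v) * d v ≡ F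
      r-d v pos = r-inverse pos (degree≤n G v)

      r-d⁻ : ∀ v → 0 < d⁻ v → r (d⁻ v) * d⁻ v ≡ F
      r-d⁻ v pos = r-inverse pos (≤-trans (pred[n]≤n) (degree≤n G v))

      inner-sym : ∀ v u → inner v u ≡ inner u v
      inner-sym v u = Graph.sym G′ v u

      inner⇒d>0 : ∀ v u → inner v u ≡ true → 0 < d v
      inner⇒d>0 v u e = adj⇒degree>0 G v u (proj₁ (isolate-adj G w v u e))

      inner⇒d⁻>0 : ∀ v u → near v ≡ true → inner v u ≡ true → 0 < d⁻ v
      inner⇒d⁻>0 v u nv e = subst (0 <_) (degree-near⁻ v nv) (adj⇒degree>0 G′ v u e)

      open ≤-Reasoning

      -- The ordered pair (v, u) is charged to A at (v, u) if v ~ w, and to B at the reversed pair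
      -- (u, v) if u ~ w. After transposing B, both factors at a pair belong to the same neighbour v
      -- and have the same Gibbs exponent. If both ends are near, `scaled-triangle` produces the two
      -- factors at the price of κ.
      edge-step : ∀ x v u → (edgeBound G′ (L′ x) v u when inner v u) * κ u v ≤
                  (A v u x when out v u) * (B u v x when out u v) * rest v u
      edge-step x v u = go (inner v u) (inner u v) (near v) (near u) (inner-sym v u) refl refl refl
        where
        edgeBound-≡ : ∀ {a b V U} → degree G′ v ≡ b → degree G′ u ≡ a → L′ x v ≡ V → L′ x u ≡ U →
                      edgeBound G′ (L′ x) v u ≡ biclique a b V U ^ (r b * r a)
        edgeBound-≡ refl refl refl refl = refl
        go : ∀ i j nv nu → i ≡ j → inner v u ≡ i → near v ≡ nv → near u ≡ nu →
             (edgeBound G′ (L′ x) v u when i) * (total (L u) ^ (r (d u) * F) when (nu ∧ j) ∧ nv) ≤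
             (A v u x when nv ∧ i) * ((if nv then total (L u ∖ x) ^ (r (d⁻ u) * F) else A u v x) when nu ∧ j) *
             (E v u when i ∧ (not nv ∧ not nu))
        go false _ nv nu refl vu ev eu rewrite ∧-zeroʳ nu | ∧-zeroʳ nv = ≤-refl
        go true  _ nv nu refl vu ev eu = go′ nv nu ev eu
          where
          uv = trans (sym (inner-sym v u)) vu
          v≢w = proj₁ (proj₂ (isolate-adj G w v u vu))
          u≢w = proj₂ (proj₂ (isolate-adj G w v u vu))
          go′ : ∀ nv nu → near v ≡ nv → near u ≡ nu →
             edgeBound G′ (L′ x) v u * (total (L u) ^ (r (d u) * F) when (nu ∧ true) ∧ nv) ≤
             (A v u x when nv ∧ true) * ((if nv then total (L u ∖ x) ^ (r (d⁻ u) * F) else A u v x) when nu ∧ true) *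
             (E v u when not nv ∧ not nu)
          go′ true true ev eu = begin
            edgeBound G′ (L′ x) v u * total (L u) ^ (r (d u) * F)
              ≡⟨ cong (_* total (L u) ^ (r (d u) * F)) (edgeBound-≡ (degree-near⁻ v ev) (degree-near⁻ u eu)
                   (assign-near G w x L v v≢w ev) (assign-near G w x L u u≢w eu)) ⟩
            biclique (d⁻ u) (d⁻ v) (L v ∖ x) (L u ∖ x) ^ (r (d⁻ v) * r (d⁻ u)) * total (L u) ^ (r (d u) * F)
              ≤⟨ scaled-triangle (L v) (L u) x (d⁻ u) (d⁻ v) (degree-near-suc u eu) (r-d u (inner⇒d>0 u v uv))
                   (r-d⁻ u (inner⇒d⁻>0 u v eu uv)) (r-d⁻ v (inner⇒d⁻>0 v u ev vu)) ⟩
            A v u x * total (L u ∖ x) ^ (r (d⁻ u) * F)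
              ≡⟨ *-identityʳ _ ⟨
            A v u x * total (L u ∖ x) ^ (r (d⁻ u) * F) * 1 ∎
          go′ true false ev eu = ≤-reflexive (cong (λ z → z * 1) (trans
            (edgeBound-≡ (degree-near⁻ v ev) (degree-far u u≢w eu) (assign-near G w x L v v≢w ev) (assign-far G w x L u u≢w eu))
            (trans (cong (biclique (d u) (d⁻ v) (L v ∖ x) (L u) ^_) (*-comm (r (d⁻ v)) (r (d u)))) (sym (*-identityʳ _)))))
          go′ false true ev eu = ≤-reflexive (cong (λ z → z * 1) (trans
            (edgeBound-≡ (degree-far v v≢w ev) (degree-near⁻ u eu) (assign-far G w x L v v≢w ev) (assign-near G w x L u u≢w eu))
            (trans (cong (_^ (r (d v) * r (d⁻ u))) (biclique-comm (d⁻ u) (d v) (L v) (L u ∖ x))) (sym (+-identityʳ _)))))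
          go′ false false ev eu = ≤-reflexive (trans (*-identityʳ _) (trans
            (edgeBound-≡ (degree-far v v≢w ev) (degree-far u u≢w eu) (assign-far G w x L v v≢w ev) (assign-far G w x L u u≢w eu))
            (trans (cong (biclique (d u) (d v) (L v) (L u) ^_) (*-comm (r (d v)) (r (d u)))) (sym (+-identityʳ _)))))

      -- Only two kinds of vertices become isolated: `w`, whose list has total 1, and neighbours of
      -- degree 1, which are paid for by the factor under `alone`.
      vertex-step : ∀ x v → vertexBound G′ (L′ x) v ≤ (total (L v ∖ x) ^ (2 * (F * F)) when alone v) * vertexBound G L v
      vertex-step x v = go (v ≟ w) (near v) refl
        where
        vertexBound-≡ : ∀ {b V} → degree G′ v ≡ b → L′ x v ≡ V → vertexBound G′ (L′ x) v ≡ (total V ^ (2 * (F * F)) when isZero b)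
        vertexBound-≡ refl refl = refl
        zero-rest : ∀ b k → b ≡ suc k → ∀ X → (X when isZero b) ≡ 1
        zero-rest _ _ refl X = refl
        go : Dec (v ≡ w) → ∀ nv → near v ≡ nv →
             vertexBound G′ (L′ x) v ≤ (total (L v ∖ x) ^ (2 * (F * F)) when nv ∧ isZero (d⁻ v)) * vertexBound G L v
        go (yes refl) true  ev = ⊥-elim (near≢w v ev refl)
        go (yes refl) false ev = ≤-reflexive (trans (vertexBound-≡ (isolate-degree-self G w) (assign-self G w x L))
          (trans (cong (_^ (2 * (F * F))) (total-δ x)) (trans (^-zeroˡ (2 * (F * F)))
            (sym (trans (+-identityʳ _) (zero-rest (d w) (d⁻ w) (sym (suc-pred (d w) {{>-nonZero deg-w>0}})) _))))))
        go (no v≢w)   true  ev = ≤-reflexive (trans (vertexBound-≡ (degree-near⁻ v ev) (assign-near G w x L v v≢w ev))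
          (sym (trans (cong ((total (L v ∖ x) ^ (2 * (F * F)) when isZero (d⁻ v)) *_) (zero-rest (d v) (d⁻ v) (degree-near-suc v ev) _)) (*-identityʳ _))))
        go (no v≢w)   false ev = ≤-reflexive (trans (vertexBound-≡ (degree-far v v≢w ev) (assign-far G w x L v v≢w ev)) (sym (+-identityʳ _)))

      φ : Fin n → Fin q → ℕ
      φ v x = (total (L v ∖ x) ^ (2 * (F * F)) when alone v) * ∏ (allFin n) (λ u → A v u x * B v u x when out v u)

      bound-step : ∀ x → ∏² κ * graphBound G′ (L′ x) ≤ ∏ (allFin n) (vertexBound G L) * ∏² rest * ∏ (allFin n) (λ v → φ v x)
      bound-step x = begin
        ∏² κ * (∏ (allFin n) (vertexBound G′ (L′ x)) * ∏² X)
          ≡⟨ eq₁ (∏² κ) (∏ (allFin n) (vertexBound G′ (L′ x))) (∏² X) ⟩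
        ∏ (allFin n) (vertexBound G′ (L′ x)) * (∏² X * ∏² κ)
          ≤⟨ *-mono-≤ vertices edges′ ⟩
        ∏ (allFin n) alone-factor * ∏ (allFin n) (vertexBound G L) * (∏² A′ * ∏² B′ * ∏² rest)
          ≡⟨ eq₂ (∏ (allFin n) alone-factor) _ (∏² A′) (∏² B′) (∏² rest) ⟩
        ∏ (allFin n) (vertexBound G L) * ∏² rest * (∏ (allFin n) alone-factor * (∏² A′ * ∏² B′))
          ≡⟨ cong (∏ (allFin n) (vertexBound G L) * ∏² rest *_) (trans (cong (∏ (allFin n) alone-factor *_)
               (trans (sym (∏²-* A′ B′)) (∏²-cong (λ v u → sym (when-* (A v u x) (B v u x) (out v u)))))) (sym (∏-* (allFin n) _ _))) ⟩
        ∏ (allFin n) (vertexBound G L) * ∏² rest * ∏ (allFin n) (λ v → φ v x) ∎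
        where
        X A′ B′ : Fin n → Fin n → ℕ
        X v u = edgeBound G′ (L′ x) v u when inner v u
        A′ v u = A v u x when out v u
        B′ v u = B v u x when out v u
        alone-factor : Fin n → ℕ
        alone-factor v = total (L v ∖ x) ^ (2 * (F * F)) when alone v
        eq₁ : ∀ a b c → a * (b * c) ≡ b * (c * a)
        eq₁ = solve-∀
        eq₂ : ∀ a b c d e → a * b * (c * d * e) ≡ b * e * (a * (c * d))
        eq₂ = solve-∀
        vertices : ∏ (allFin n) (vertexBound G′ (L′ x)) ≤ ∏ (allFin n) alone-factor * ∏ (allFin n) (vertexBound G L)
        vertices = ≤-trans (∏-mono (allFin n) (vertex-step x)) (≤-reflexive (∏-* (allFin n) _ _))
        edges′ : ∏² X * ∏² κ ≤ ∏² A′ * ∏² B′ * ∏² rest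
        edges′ = begin
          ∏² X * ∏² κ                                   ≡⟨ cong (∏² X *_) (∏²-swap κ) ⟩
          ∏² X * ∏² (λ v u → κ u v)                     ≡⟨ ∏²-* X (λ v u → κ u v) ⟨
          ∏² (λ v u → X v u * κ u v)                    ≤⟨ ∏²-mono (edge-step x) ⟩
          ∏² (λ v u → A′ v u * B′ u v * rest v u)       ≡⟨ ∏²-* (λ v u → A′ v u * B′ u v) rest ⟩
          ∏² (λ v u → A′ v u * B′ u v) * ∏² rest        ≡⟨ cong (_* ∏² rest) (∏²-* A′ (λ v u → B′ u v)) ⟩
          ∏² A′ * ∏² (λ v u → B′ u v) * ∏² rest         ≡⟨ cong (λ z → ∏² A′ * z * ∏² rest) (∏²-swap B′) ⟨
          ∏² A′ * ∏² B′ * ∏² rest                       ∎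

      C : Fin n → ℕ
      C v = ∏ (allFin n) (λ u → E v u * B∞ v u when out v u)

      ∧-true : ∀ {a b} → a ∧ b ≡ true → a ≡ true × b ≡ true
      ∧-true {true} {true} _ = refl , refl

      edge-gibbs : ∀ v u → out v u ≡ true →
        WeightedGibbs (L w) (2 * (F * F * r (d⁻ v))) (λ x → (A v u x * B v u x) ^ (F * Δ))
          (N v ^ (2 * (F * (r (d v) * r (d⁻ v)))) * (E v u * B∞ v u) ^ (F * Δ))
      edge-gibbs v u e = wg-resp (double (F * F * r (d⁻ v))) (λ x → sym (^-distribʳ-* (A v u x) (B v u x) (F * Δ)))
        (monomial-≡ (N v ∷ E v u ∷ B∞ v u ∷ []) (F * (r (d v) * r (d⁻ v)) ∷ F * Δ ∷ [])
          (v0 ↑ x0 ⊗ v1 ↑ x1 ⊗ (v0 ↑ x0 ⊗ v2 ↑ x1)) (v0 ↑ (con 2 :* x0) ⊗ (v1 ⊗ v2) ↑ x1) refl)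
        (wg-* gibbs-A gibbs-B)
        where
        double : ∀ k → k + k ≡ 2 * k
        double = solve-∀
        nv = proj₁ (∧-true e)
        vu = proj₂ (∧-true {near v} e)
        uv = trans (sym (inner-sym v u)) vu
        rb = r-d v (inner⇒d>0 v u vu)
        rβ = r-d⁻ v (inner⇒d⁻>0 v u nv vu)
        gibbs-A : WeightedGibbs (L w) (F * F * r (d⁻ v)) (λ x → A v u x ^ (F * Δ)) (N v ^ (F * (r (d v) * r (d⁻ v))) * E v u ^ (F * Δ))
        gibbs-A = scaled-edge-bound (L w) (L v) (L u) (d⁻ v) (degree-near-suc v nv) (r-d u (inner⇒d>0 u v uv)) rb rβ
                    (inner⇒d>0 u v uv) (deg-w-max u)
        gibbs-B : WeightedGibbs (L w) (F * F * r (d⁻ v)) (λ x → B v u x ^ (F * Δ)) (N v ^ (F * (r (d v) * r (d⁻ v))) * B∞ v u ^ (F * Δ))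
        gibbs-B with near u
        ... | true  = scaled-total-bound (L w) (L v) (d⁻ v) (degree-near-suc v nv) rb rβ deg-w>0
        ... | false = gibbs-A

      -- Every neighbour of w gets the exponent 2F³: either d⁻ v edges with 2F² r(d⁻ v) each, or the
      -- isolated factor if there are no such edges. The powers of N v add up to 2F² r(d v) in both
      -- cases.
      vertex-gibbs : ∀ v → WeightedGibbs (L w) (bit (near v) * (2 * (F * F) * F)) (λ x → φ v x ^ (F * Δ))
        ((N v ^ (2 * (F * F) * r (d v)) when near v) * C v ^ (F * Δ))
      vertex-gibbs v = wg-resp s-eq φ-eq Y-eq (wg-* gibbs-alone gibbs-edges)
        where
        k = 2 * (F * (r (d v) * r (d⁻ v)))
        gibbs-alone : WeightedGibbs (L w) (bit (alone v) * (2 * (F * F) * F))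
          (λ x → (total (L v ∖ x) ^ (2 * (F * F))) ^ (F * Δ) when alone v) (N v ^ (2 * (F * F) * r (d v)) when alone v)
        gibbs-alone = wg-when (alone v) (λ e → scaled-isolated-bound (L w) (L v)
          (trans (degree-near-suc v (proj₁ (∧-true e))) (cong suc (isZero-true (d⁻ v) (proj₂ (∧-true {near v} e)))))
          (r-d v (subst (0 <_) (sym (degree-near-suc v (proj₁ (∧-true e)))) (s≤s z≤n))) deg-w>0)
          where
          isZero-true : ∀ k → isZero k ≡ true → k ≡ 0
          isZero-true zero _ = refl
        gibbs-edges : WeightedGibbs (L w) (∑ (allFin n) (λ u → bit (out v u) * (2 * (F * F * r (d⁻ v)))))
          (λ x → ∏ (allFin n) (λ u → (A v u x * B v u x) ^ (F * Δ) when out v u))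
          (∏ (allFin n) (λ u → N v ^ k * (E v u * B∞ v u) ^ (F * Δ) when out v u))
        gibbs-edges = wg-∏ (allFin n) (λ u → wg-when (out v u) (edge-gibbs v u))
        φ-eq : ∀ x → (( total (L v ∖ x) ^ (2 * (F * F))) ^ (F * Δ) when alone v) * ∏ (allFin n) (λ u → (A v u x * B v u x) ^ (F * Δ) when out v u) ≡ φ v x ^ (F * Δ)
        φ-eq x = trans (cong₂ _*_ (when-^ _ (F * Δ) (alone v)) (trans (∏-cong (allFin n) (λ u → when-^ _ (F * Δ) (out v u))) (∏-^ (allFin n) (F * Δ) _)))
                   (sym (^-distribʳ-* _ _ (F * Δ)))
        out-count : ∀ nv → near v ≡ nv → ∑ (allFin n) (λ u → bit (nv ∧ inner v u)) ≡ bit nv * d⁻ v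
        out-count false ev = ∑-0 (allFin n)
        out-count true  ev = trans (degree-near⁻ v ev) (sym (+-identityʳ _))
        exponents : ∀ t → t * d⁻ v ≡ 2 * (F * F) * (r (d⁻ v) * d⁻ v) → ∀ nv → near v ≡ nv →
          bit (nv ∧ isZero (d⁻ v)) * (2 * (F * F) * F) + ∑ (allFin n) (λ u → bit (nv ∧ inner v u)) * t ≡ bit nv * (2 * (F * F) * F)
        exponents t ht nv ev = trans (cong (λ c → bit (nv ∧ isZero (d⁻ v)) * (2 * (F * F) * F) + c * t) (out-count nv ev)) (go nv (d⁻ v) ht (r-d⁻ v))
          where
          eq : ∀ b t → 0 + (1 * b) * t ≡ t * b
          eq = solve-∀
          go : ∀ nv β → t * β ≡ 2 * (F * F) * (r β * β) → (0 < β → r β * β ≡ F) →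
               bit (nv ∧ isZero β) * (2 * (F * F) * F) + bit nv * β * t ≡ bit nv * (2 * (F * F) * F)
          go false β       ht hr = refl
          go true  zero    ht hr = +-identityʳ _
          go true  (suc β) ht hr = trans (eq (suc β) t) (trans ht (trans (cong (2 * (F * F) *_) (hr (s≤s z≤n))) (sym (+-identityʳ _))))
        s-eq : bit (alone v) * (2 * (F * F) * F) + ∑ (allFin n) (λ u → bit (out v u) * (2 * (F * F * r (d⁻ v)))) ≡ bit (near v) * (2 * (F * F) * F)
        s-eq = trans (cong (bit (alone v) * (2 * (F * F) * F) +_) (∑-*ʳ (allFin n) _ _))
          (exponents (2 * (F * F * r (d⁻ v))) (eq F (r (d⁻ v)) (d⁻ v)) (near v) refl)
          where
          eq : ∀ f x b → 2 * (f * f * x) * b ≡ 2 * (f * f) * (x * b)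
          eq = solve-∀
        N-eq : (N v ^ (2 * (F * F) * r (d v)) when alone v) * ∏ (allFin n) (λ u → N v ^ k when out v u) ≡ (N v ^ (2 * (F * F) * r (d v)) when near v)
        N-eq = begin-equality
          (N v ^ (2 * (F * F) * r (d v)) when alone v) * ∏ (allFin n) (λ u → N v ^ k when out v u)
            ≡⟨ cong₂ _*_ (when-bit (N v) _ (alone v)) (∏-when-const (allFin n) (N v) k (out v)) ⟩
          N v ^ (bit (alone v) * (2 * (F * F) * r (d v))) * N v ^ (∑ (allFin n) (λ u → bit (out v u)) * k)
            ≡⟨ ^-distribˡ-+-* (N v) (bit (alone v) * (2 * (F * F) * r (d v))) _ ⟨
          N v ^ (bit (alone v) * (2 * (F * F) * r (d v)) + ∑ (allFin n) (λ u → bit (out v u)) * k)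
            -- Multiplied by F, the exponent of N v is r(d v) times the Gibbs exponent, so the count
            -- made in `exponents` applies again.
            ≡⟨ cong (N v ^_) (*-cancelʳ-≡ (bit (alone v) * (2 * (F * F) * r (d v)) + ∑ (allFin n) (λ u → bit (out v u)) * k) (bit (near v) * (2 * (F * F) * r (d v))) F {{>-nonZero F>0}} (trans (eq₁ (bit (alone v)) F (r (d v)) (∑ (allFin n) (λ u → bit (out v u))) (r (d⁻ v)))
                 (trans (cong (r (d v) *_) (exponents (2 * (F * F * r (d⁻ v))) (eq₃ F (r (d⁻ v)) (d⁻ v)) (near v) refl)) (eq₂ (bit (near v)) F (r (d v)))))) ⟩
          N v ^ (bit (near v) * (2 * (F * F) * r (d v)))
            ≡⟨ when-bit (N v) _ (near v) ⟨
          (N v ^ (2 * (F * F) * r (d v)) when near v) ∎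
          where
          eq₁ : ∀ a f b c y → (a * (2 * (f * f) * b) + c * (2 * (f * (b * y)))) * f ≡ b * (a * (2 * (f * f) * f) + c * (2 * (f * f * y)))
          eq₁ = solve-∀
          eq₂ : ∀ a f b → b * (a * (2 * (f * f) * f)) ≡ a * (2 * (f * f) * b) * f
          eq₂ = solve-∀
          eq₃ : ∀ f x b → 2 * (f * f * x) * b ≡ 2 * (f * f) * (x * b)
          eq₃ = solve-∀
        Y-eq : (N v ^ (2 * (F * F) * r (d v)) when alone v) * ∏ (allFin n) (λ u → N v ^ k * (E v u * B∞ v u) ^ (F * Δ) when out v u) ≡
               (N v ^ (2 * (F * F) * r (d v)) when near v) * C v ^ (F * Δ)
        Y-eq = begin-equality
          (N v ^ (2 * (F * F) * r (d v)) when alone v) * ∏ (allFin n) (λ u → N v ^ k * (E v u * B∞ v u) ^ (F * Δ) when out v u)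
            ≡⟨ cong ((N v ^ (2 * (F * F) * r (d v)) when alone v) *_) (trans (∏-cong (allFin n) (λ u →
                 trans (when-* (N v ^ k) _ (out v u)) (cong ((N v ^ k when out v u) *_) (when-^ _ (F * Δ) (out v u)))))
                 (trans (∏-* (allFin n) _ _) (cong (∏ (allFin n) (λ u → N v ^ k when out v u) *_) (∏-^ (allFin n) (F * Δ) _)))) ⟩
          (N v ^ (2 * (F * F) * r (d v)) when alone v) * (∏ (allFin n) (λ u → N v ^ k when out v u) * C v ^ (F * Δ))
            ≡⟨ *-assoc (N v ^ (2 * (F * F) * r (d v)) when alone v) _ _ ⟨
          (N v ^ (2 * (F * F) * r (d v)) when alone v) * ∏ (allFin n) (λ u → N v ^ k when out v u) * C v ^ (F * Δ)
            ≡⟨ cong (_* C v ^ (F * Δ)) N-eq ⟩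
          (N v ^ (2 * (F * F) * r (d v)) when near v) * C v ^ (F * Δ) ∎

      star : Fin n → ℕ
      star v = edgeBound G L w v when near v

      -- The Δ neighbours together have exponent 2F² · FΔ, and a root of order FΔ leaves the power
      -- 2F² of the induction. By F = r Δ · Δ the same root turns N v into `star v` squared, the
      -- square accounting for the two ordered pairs of the edge wv.
      all-gibbs : WeightedGibbs (L w) (2 * (F * F)) (λ x → ∏ (allFin n) (λ v → φ v x)) (∏ (allFin n) (λ v → star v * star v * C v))
      all-gibbs = wg-root (F * Δ) (*-mono-≤ F>0 deg-w>0) (wg-resp s-eq (λ x → ∏-^ (allFin n) (F * Δ) _)
        (trans (∏-cong (allFin n) Y-eq) (∏-^ (allFin n) (F * Δ) _)) (wg-∏ (allFin n) vertex-gibbs))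
        where
        s-eq : ∑ (allFin n) (λ v → bit (near v) * (2 * (F * F) * F)) ≡ 2 * (F * F) * (F * Δ)
        s-eq = trans (∑-*ʳ (allFin n) _ _) (eq Δ F)
          where
          eq : ∀ D f → D * (2 * (f * f) * f) ≡ 2 * (f * f) * (f * D)
          eq = solve-∀
        Y-eq : ∀ v → (N v ^ (2 * (F * F) * r (d v)) when near v) * C v ^ (F * Δ) ≡ (star v * star v * C v) ^ (F * Δ)
        Y-eq v = trans (cong (_* C v ^ (F * Δ)) (go (near v))) (sym (^-distribʳ-* (star v * star v) (C v) (F * Δ)))
          where
          eq₁ : ∀ f b y D → 2 * (f * (y * D)) * b ≡ 2 * (y * b) * (f * D)
          eq₁ = solve-∀
          go : ∀ nv → (N v ^ (2 * (F * F) * r (d v)) when nv) ≡ ((edgeBound G L w v when nv) * (edgeBound G L w v when nv)) ^ (F * Δ)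
          go false = sym (^-zeroˡ (F * Δ))
          go true  = trans (cong (N v ^_) (trans (cong (λ f → 2 * (F * f) * r (d v)) (sym (r-d w deg-w>0))) (eq₁ F (r (d v)) (r Δ) Δ)))
            (monomial-≡ (N v ∷ []) (r Δ * r (d v) ∷ F * Δ ∷ []) (v0 ↑ (con 2 :* x0 :* x1)) ((v0 ↑ x0 ⊗ v0 ↑ x0) ↑ x1) refl)

      X : Fin n → Fin n → ℕ
      X v u = edgeBound G L v u when Adj G v u

      edgeBound-comm : ∀ v u → edgeBound G L v u ≡ edgeBound G L u v
      edgeBound-comm v u = cong₂ _^_ (biclique-comm (d u) (d v) (L v) (L u)) (*-comm (r (d v)) (r (d u)))

      edgeBound-E : ∀ v u → edgeBound G L v u ≡ E v u
      edgeBound-E v u = cong (biclique (d u) (d v) (L v) (L u) ^_) (*-comm (r (d v)) (r (d u)))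

      E-comm : ∀ v u → E v u ≡ E u v
      E-comm v u = trans (sym (edgeBound-E v u)) (trans (edgeBound-comm v u) (edgeBound-E u v))

      X-comm : ∀ v u → X v u ≡ X u v
      X-comm v u = cong₂ _when_ (edgeBound-comm v u) (Graph.sym G v u)

      E′ B′ : Fin n → Fin n → ℕ
      E′ v u = E v u when out v u
      B′ v u = E v u when out v u ∧ not (near u)

      -- If u ~ w, then B∞ is precisely the denominator κ; otherwise it is the second copy of E, due
      -- to the reversed pair.
      out-split : ∀ v u → (E v u * B∞ v u when out v u) ≡ E′ v u * (κ v u * B′ v u)
      out-split v u = go (out v u) (near u)
        where
        go : ∀ o nu → (E v u * (if nu then total (L v) ^ (r (d v) * F) else E v u) when o) ≡
             (E v u when o) * ((total (L v) ^ (r (d v) * F) when o ∧ nu) * (E v u when o ∧ not nu))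
        go false nu    = refl
        go true  true  = cong (E v u *_) (sym (*-identityʳ _))
        go true  false = cong (E v u *_) (sym (+-identityʳ _))

      -- Pairs containing w give `star`. Any other edge takes its factor from `rest` if neither end
      -- is near w, from E′ if v is near, and from the transposed B′ if only u is near.
      edge-split : ∀ v u → X v u ≡ (X w u when ⌊ v ≟ w ⌋) * (X v w when ⌊ u ≟ w ⌋) * (rest v u * E′ v u * B′ u v)
      edge-split v u = go (v ≟ w) (u ≟ w)
        where
        I = rest v u * E′ v u * B′ u v
        X-self : ∀ v → X v v ≡ 1
        X-self v = cong (edgeBound G L v v when_) (irrefl G v)
        inner-w : ∀ v u → (v ≡ w) ⊎ (u ≡ w) → inner v u ≡ false
        inner-w v u h with inner v u in e
        ... | false = refl
        ... | true with isolate-adj G w v u e | h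
        ...   | _ , v≢w , _ | inj₁ p = ⊥-elim (v≢w p)
        ...   | _ , _ , u≢w | inj₂ p = ⊥-elim (u≢w p)
        inner-off : v ≢ w → u ≢ w → inner v u ≡ Adj G v u
        inner-off v≢w u≢w with v ≟ w | u ≟ w
        ... | yes p | _     = ⊥-elim (v≢w p)
        ... | no _  | yes p = ⊥-elim (u≢w p)
        ... | no _  | no _  = ∧-identityʳ (Adj G v u)
        I-≡ : ∀ i → inner v u ≡ i → I ≡ (E v u when i)
        I-≡ i e = subst₂ (λ j k → (E v u when j ∧ (not (near v) ∧ not (near u))) * (E v u when near v ∧ j) *
                                  (E u v when (near u ∧ k) ∧ not (near v)) ≡ (E v u when i)) (sym e)
                    (trans (sym e) (inner-sym v u)) (go i (near v) (near u))
          where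
          go : ∀ i nv nu → (E v u when i ∧ (not nv ∧ not nu)) * (E v u when nv ∧ i) * (E u v when (nu ∧ i) ∧ not nv) ≡ (E v u when i)
          go false false false = refl
          go false false true  = refl
          go false true  false = refl
          go false true  true  = refl
          go true  false false = trans (*-identityʳ _) (*-identityʳ _)
          go true  false true  = trans (+-identityʳ _) (E-comm u v)
          go true  true  false = trans (*-identityʳ _) (+-identityʳ _)
          go true  true  true  = trans (*-identityʳ _) (+-identityʳ _)
        go : (dv : Dec (v ≡ w)) (du : Dec (u ≡ w)) → X v u ≡ (X w u when ⌊ dv ⌋) * (X v w when ⌊ du ⌋) * I
        go (yes refl) (yes refl) rewrite I-≡ false (inner-w v u (inj₁ refl)) | X-self v = refl
        go (yes refl) (no _)     rewrite I-≡ false (inner-w v u (inj₁ refl)) = sym (trans (*-identityʳ _) (*-identityʳ _))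
        go (no _)     (yes refl) rewrite I-≡ false (inner-w v u (inj₂ refl)) = sym (trans (*-identityʳ _) (+-identityʳ _))
        go (no v≢w)   (no u≢w)   rewrite I-≡ (Adj G v u) (inner-off v≢w u≢w) = trans (cong (_when Adj G v u) (edgeBound-E v u)) (sym (+-identityʳ _))

      ∏²-X : ∏² X ≡ ∏ (allFin n) star * ∏ (allFin n) star * (∏² rest * ∏² E′ * ∏² B′)
      ∏²-X = begin-equality
        ∏² X
          ≡⟨ ∏²-cong edge-split ⟩
        ∏² (λ v u → (X w u when ⌊ v ≟ w ⌋) * (X v w when ⌊ u ≟ w ⌋) * (rest v u * E′ v u * B′ u v))
          ≡⟨ trans (∏²-* _ (λ v u → rest v u * E′ v u * B′ u v)) (cong₂ _*_ (∏²-* (λ v u → X w u when ⌊ v ≟ w ⌋) _)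
               (trans (∏²-* (λ v u → rest v u * E′ v u) (λ v u → B′ u v)) (cong₂ _*_ (∏²-* rest E′) (sym (∏²-swap B′))))) ⟩
        ∏² (λ v u → X w u when ⌊ v ≟ w ⌋) * ∏² (λ v u → X v w when ⌊ u ≟ w ⌋) * (∏² rest * ∏² E′ * ∏² B′)
          ≡⟨ cong (_* (∏² rest * ∏² E′ * ∏² B′)) (cong₂ _*_
               (trans (∏²-swap (λ v u → X w u when ⌊ v ≟ w ⌋)) (∏-cong (allFin n) (λ u → ∏-delta n (λ _ → X w u) w)))
               (∏-cong (allFin n) (λ v → trans (∏-delta n (λ _ → X v w) w) (X-comm v w)))) ⟩
        ∏ (allFin n) star * ∏ (allFin n) star * (∏² rest * ∏² E′ * ∏² B′) ∎

      ∏-C : ∏ (allFin n) C ≡ ∏² E′ * (∏² κ * ∏² B′)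
      ∏-C = trans (∏²-cong out-split) (trans (∏²-* E′ _) (cong (∏² E′ *_) (∏²-* κ B′)))

    -- As κ does not depend on x, it passes through the sum over x as a constant and reappears on
    -- the right through `∏-C`. Nonempty lists make it positive, hence cancellable.
    step : (∀ v → 0 < total (L v)) → (∀ x → partition (isolate G w) (assign G w x L) ^ (2 * (F * F)) ≤ graphBound (isolate G w) (assign G w x L)) →
           partition G L ^ (2 * (F * F)) ≤ graphBound G L
    step lists>0 hyp = *-cancelˡ-≤′ κ>0 (begin
      ∏² κ * partition G L ^ (2 * (F * F))
        ≤⟨ *-monoʳ-≤ (∏² κ) (^-monoˡ-≤ (2 * (F * F)) (partition-isolate G L w)) ⟩
      ∏² κ * total (λ x → L w x * partition G′ (L′ x)) ^ (2 * (F * F))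
        ≤⟨ wg⇒∑-bound all-gibbs (*-mono-≤ {1} {2} (s≤s z≤n) (*-mono-≤ F>0 F>0)) (∏² κ) (∏V * ∏² rest) (λ x → partition G′ (L′ x))
             (λ x → ≤-trans (*-monoʳ-≤ (∏² κ) (hyp x)) (bound-step x)) ⟩
      ∏V * ∏² rest * ∏ (allFin n) (λ v → star v * star v * C v)
        ≡⟨ cong (∏V * ∏² rest *_) (trans (∏-* (allFin n) _ C) (cong₂ _*_ (∏-* (allFin n) star star) ∏-C)) ⟩
      ∏V * ∏² rest * (∏ (allFin n) star * ∏ (allFin n) star * (∏² E′ * (∏² κ * ∏² B′)))
        ≡⟨ eq ∏V (∏² rest) (∏ (allFin n) star) (∏² E′) (∏² κ) (∏² B′) ⟩
      ∏² κ * (∏V * (∏ (allFin n) star * ∏ (allFin n) star * (∏² rest * ∏² E′ * ∏² B′)))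
        ≡⟨ cong (λ z → ∏² κ * (∏V * z)) ∏²-X ⟨
      ∏² κ * graphBound G L ∎)
      where
      ∏V = ∏ (allFin n) (vertexBound G L)
      eq : ∀ v t s e k b → v * t * (s * s * (e * (k * b))) ≡ k * (v * (s * s * (t * e * b)))
      eq = solve-∀
      when>0 : ∀ {x} b → 0 < x → 0 < (x when b)
      when>0 false _ = s≤s z≤n
      when>0 true  h = h
      κ>0 : 0 < ∏² κ
      κ>0 = ∏>0 (allFin n) _ (λ v → ∏>0 (allFin n) _ (λ u → when>0 (out v u ∧ near u) (^>0 (r (d v) * F) (lists>0 v))))

  -- The sum of the degrees, bounded by `k`, decreases because `w` has positive degree. If some list
  -- is empty, the left side is 0, so `step` is called only with nonempty lists.
  partition-bound : ∀ k G L → ∑ (allFin n) (degree G) ≤ k → partition G L ^ (2 * (F * F)) ≤ graphBound G L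
  partition-bound k G L size with maximum n (degree G) | 1 ≤? ∏ (allFin n) (λ v → total (L v))
  ... | inj₁ no-edges | _ = begin
    partition G L ^ (2 * (F * F))
      ≤⟨ ^-monoˡ-≤ (2 * (F * F)) (partition≤∏-total G L) ⟩
    ∏ (allFin n) (λ v → total (L v)) ^ (2 * (F * F))
      ≡⟨ ∏-^ (allFin n) (2 * (F * F)) _ ⟨
    ∏ (allFin n) (λ v → total (L v) ^ (2 * (F * F)))
      ≡⟨ ∏-cong (allFin n) (λ v → cong (λ b → total (L v) ^ (2 * (F * F)) when isZero b) (no-edges v)) ⟨
    ∏ (allFin n) (vertexBound G L)
      ≡⟨ trans (cong (∏ (allFin n) (vertexBound G L) *_) (trans (∏²-cong no-edge) (trans (∏-cong (allFin n) (λ _ → ∏-1 (allFin n))) (∏-1 (allFin n))))) (*-identityʳ _) ⟨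
    graphBound G L ∎
    where
    open ≤-Reasoning
    no-edge : ∀ v u → (edgeBound G L v u when Adj G v u) ≡ 1
    no-edge v u with Adj G v u in e
    ... | false = refl
    ... | true  = ⊥-elim (<⇒≱ (adj⇒degree>0 G v u e) (≤-reflexive (no-edges v)))
  ... | inj₂ _ | no empty = ≤-trans (^-monoˡ-≤ (2 * (F * F)) (≤-trans (partition≤∏-total G L) (≤-pred (≰⇒> empty))))
                              (≤-trans (≤-reflexive (0^k (*-mono-≤ {1} {2} (s≤s z≤n) (*-mono-≤ F>0 F>0)))) z≤n)
    where
    0^k : ∀ {k} → 0 < k → 0 ^ k ≡ 0
    0^k (s≤s _) = refl
  partition-bound zero G L size | inj₂ (w , pos , _) | yes _ = ⊥-elim (<⇒≱ pos (≤-trans (∑-allFin-≥ n (degree G) w) size))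
  partition-bound (suc k) G L size | inj₂ (w , pos , max) | yes lists>0 =
    step G L w pos max (∏-factor>0 n (λ v → total (L v)) lists>0)
      (λ x → partition-bound k (isolate G w) (assign G w x L) (≤-pred (≤-trans fewer size)))
    where
    open ≤-Reasoning
    degree-mono : ∀ v → degree (isolate G w) v * ne w v ≤ degree G v * ne w v
    degree-mono v with w ≟ v
    ... | yes _ = ≤-reflexive (trans (*-zeroʳ (degree (isolate G w) v)) (sym (*-zeroʳ (degree G v))))
    ... | no w≢v = *-monoˡ-≤ 1 (≤-trans (m≤m+n (degree (isolate G w) v) _) (≤-reflexive (sym (isolate-degree G w v (λ p → w≢v (sym p))))))
    fewer : ∑ (allFin n) (degree (isolate G w)) < ∑ (allFin n) (degree G)
    fewer = begin-strict
      ∑ (allFin n) (degree (isolate G w))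
        ≡⟨ trans (∑-split (degree (isolate G w)) w) (trans (cong (∑ (allFin n) (λ v → degree (isolate G w) v * ne w v) +_) (isolate-degree-self G w)) (+-identityʳ _)) ⟩
      ∑ (allFin n) (λ v → degree (isolate G w) v * ne w v)
        ≤⟨ ∑-mono (allFin n) degree-mono ⟩
      ∑ (allFin n) (λ v → degree G v * ne w v)
        <⟨ m<m+n _ pos ⟩
      ∑ (allFin n) (λ v → degree G v * ne w v) + degree G w
        ≡⟨ ∑-split (degree G) w ⟨
      ∑ (allFin n) (degree G) ∎

-- Counting colourings

module _ {A : Set} where

  length-filterᵇ : ∀ (p : A → Bool) xs → length (filterᵇ p xs) ≡ ∑ xs (λ x → bit (p x))
  length-filterᵇ p []       = refl
  length-filterᵇ p (x ∷ xs) with p x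
  ... | true  = cong suc (length-filterᵇ p xs)
  ... | false = length-filterᵇ p xs

  ∏-filterᵇ : ∀ (p : A → Bool) xs (f : A → ℕ) → ∏ (filterᵇ p xs) f ≡ ∏ xs (λ x → f x when p x)
  ∏-filterᵇ p []       f = refl
  ∏-filterᵇ p (x ∷ xs) f with p x
  ... | true  = cong (f x *_) (∏-filterᵇ p xs f)
  ... | false = trans (∏-filterᵇ p xs f) (sym (+-identityʳ _))

  bit-allᵇ : ∀ (p : A → Bool) xs → bit (allᵇ p xs) ≡ ∏ xs (λ x → bit (p x))
  bit-allᵇ p []       = refl
  bit-allᵇ p (x ∷ xs) with p x
  ... | true  = trans (bit-allᵇ p xs) (sym (+-identityʳ _))
  ... | false = refl

deg-degree : ∀ {n} (G : Graph n) v → deg G v ≡ degree G v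
deg-degree {n} G v = length-filterᵇ (Adj G v) (allFin n)

bit-isProper : ∀ {n q} (G : Graph n) (f : Fin n → Fin q) → bit (isProper G f) ≡ ∏² (edgeFactor G f)
bit-isProper {n} G f = trans (bit-allᵇ _ (allFin n)) (∏-cong (allFin n) (λ u → bit-allᵇ _ (allFin n)))

full : ∀ {n q} → Lists {n} {q}
full _ _ = 1

colorings-partition : ∀ {n} q (G : Graph n) → colorings q G ≡ partition G (full {n} {q})
colorings-partition {n} q G = trans (length-filterᵇ (isProper G) (allMaps n q)) (∑-cong (allMaps n q) (λ f →
  trans (bit-isProper G f) (sym (trans (cong (_* ∏² (edgeFactor G f)) (∏-1 (allFin n))) (+-identityʳ _)))))

join : ∀ {q} a {b} → (Fin a → Fin q) → (Fin b → Fin q) → Fin (a + b) → Fin q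
join zero    f g = g
join (suc a) f g = extend (f zero) (join a (f ∘ suc) g)

∑-join : ∀ {q} a b (h : (Fin (a + b) → Fin q) → ℕ) →
         ∑ (allMaps (a + b) q) h ≡ ∑ (allMaps a q) (λ f → ∑ (allMaps b q) (λ g → h (join a f g)))
∑-join {q} zero    b h = sym (+-identityʳ _)
∑-join {q} (suc a) b h = trans (∑-allMaps-suc (a + b) q h) (trans
  (∑-cong (allFin q) (λ x → ∑-join a b (λ f → h (extend x f))))
  (sym (∑-allMaps-suc a q (λ f → ∑ (allMaps b q) (λ g → h (join (suc a) f g))))))

join-view : ∀ {q} a {b} (f : Fin a → Fin q) (g : Fin b → Fin q) i →
            ((toℕ i <ᵇ a) ≡ true × (∃[ i′ ] join a f g i ≡ f i′)) ⊎ ((toℕ i <ᵇ a) ≡ false × (∃[ j′ ] join a f g i ≡ g j′))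
join-view zero    f g i       = inj₂ (refl , i , refl)
join-view (suc a) f g zero    = inj₁ (refl , zero , refl)
join-view (suc a) f g (suc i) with join-view a (f ∘ suc) g i
... | inj₁ (e , i′ , e′) = inj₁ (e , suc i′ , e′)
... | inj₂ (e , j′ , e′) = inj₂ (e , j′ , e′)

biclique-colorings : ∀ {q} a b → biclique {q} a b (λ _ → 1) (λ _ → 1) ≤ colorings q (K a b)
biclique-colorings {q} a b = begin
  biclique a b (λ _ → 1) (λ _ → 1)
    ≡⟨ biclique-expand a b _ _ ⟩
  ∑ (allMaps a q) (λ f → ∑ (allMaps b q) (λ g → wt {a = a} (λ _ → 1) f * (wt {a = b} (λ _ → 1) g * disjoint f g)))
    ≡⟨ ∑-cong (allMaps a q) (λ f → ∑-cong (allMaps b q) (λ g → trans (cong₂ (λ s t → s * (t * disjoint f g)) (∏-1 (allFin a)) (∏-1 (allFin b)))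
         (trans (+-identityʳ _) (+-identityʳ _)))) ⟩
  ∑ (allMaps a q) (λ f → ∑ (allMaps b q) (disjoint f))
    ≤⟨ ∑-mono (allMaps a q) (λ f → ∑-mono (allMaps b q) (λ g → proper f g)) ⟩
  ∑ (allMaps a q) (λ f → ∑ (allMaps b q) (λ g → bit (isProper (K a b) (join a f g))))
    ≡⟨ ∑-join a b (λ h → bit (isProper (K a b) h)) ⟨
  ∑ (allMaps (a + b) q) (λ h → bit (isProper (K a b) h))
    ≡⟨ length-filterᵇ (isProper (K a b)) (allMaps (a + b) q) ⟨
  colorings q (K a b) ∎
  where
  open ≤-Reasoning
  disjoint : (Fin a → Fin q) → (Fin b → Fin q) → ℕ
  disjoint f g = ∏ (allFin b) (λ j → ∏ (allFin a) (λ i → ne (f i) (g j)))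
  disjoint≤1 : ∀ f g → disjoint f g ≤ 1
  disjoint≤1 f g = ≤-trans (∏-mono (allFin b) (λ j → avoids≤1 f (g j))) (≤-reflexive (∏-1 (allFin b)))
  proper : ∀ f g → disjoint f g ≤ bit (isProper (K a b) (join a f g))
  proper f g with 1 ≤? disjoint f g
  ... | no ¬p = ≤-trans (≤-pred (≰⇒> ¬p)) z≤n
  ... | yes p = ≤-trans (disjoint≤1 f g) (≤-reflexive (sym (trans (bit-isProper (K a b) (join a f g))
      (trans (∏²-cong each) (trans (∏-cong (allFin (a + b)) (λ _ → ∏-1 (allFin (a + b)))) (∏-1 (allFin (a + b))))))))
    where
    apart : ∀ i j → 0 < ne (f i) (g j)
    apart i j = ∏-factor>0 a _ (∏-factor>0 b _ p j) i
    ne>0 : ∀ x y → 0 < ne x y → bit (true ∧ not ⌊ x ≟ y ⌋) ≡ 1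
    ne>0 x y h with x ≟ y
    ... | no _ = refl
    each : ∀ s t → edgeFactor (K a b) (join a f g) s t ≡ 1
    each s t with join-view a f g s | join-view a f g t
    ... | inj₁ (e , _ , _)  | inj₁ (e′ , _ , _)  rewrite e | e′ = refl
    ... | inj₂ (e , _ , _)  | inj₂ (e′ , _ , _)  rewrite e | e′ = refl
    ... | inj₁ (e , i , eq) | inj₂ (e′ , j , eq′) rewrite e | e′ | eq | eq′ = ne>0 (f i) (g j) (apart i j)
    ... | inj₂ (e , j , eq) | inj₁ (e′ , i , eq′) rewrite e | e′ | eq | eq′ = ne>0 (g j) (f i) (subst (0 <_) (ne-comm (f i) (g j)) (apart i j))

-- Products over the edges

∏-edges : ∀ {n} (G : Graph n) (Y : Fin n → Fin n → ℕ) →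
          ∏ (edges G) (λ e → Y (proj₁ e) (proj₂ e)) ≡ ∏² (λ u v → Y u v when (toℕ u <ᵇ toℕ v) ∧ Adj G u v)
∏-edges {n} G Y = trans (∏-concatMap _ (allFin n) _) (∏-cong (allFin n) (λ u → trans (∏-map (u ,_) (filterᵇ _ (allFin n)) _) (∏-filterᵇ _ (allFin n) (Y u))))

-- `edges` lists an edge once, with its smaller end first, while the induction meets it in both
-- orders.
∏²-edges : ∀ {n} (G : Graph n) (Y : Fin n → Fin n → ℕ) → (∀ u v → Y u v ≡ Y v u) →
           ∏² (λ u v → Y u v when Adj G u v) ≡ ∏ (edges G) (λ e → Y (proj₁ e) (proj₂ e)) ^ 2
∏²-edges {n} G Y Y-comm = begin
  ∏² (λ u v → Y u v when Adj G u v)       ≡⟨ ∏²-cong (λ u v → orient u v) ⟩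
  ∏² (λ u v → Z u v * Z v u)              ≡⟨ ∏²-* Z (λ u v → Z v u) ⟩
  ∏² Z * ∏² (λ u v → Z v u)               ≡⟨ cong (∏² Z *_) (∏²-swap Z) ⟨
  ∏² Z * ∏² Z                             ≡⟨ cong (λ z → z * z) (∏-edges G Y) ⟨
  P * P                                   ≡⟨ cong (P *_) (*-identityʳ P) ⟨
  P ^ 2                                   ∎
  where
  open ≡-Reasoning
  P = ∏ (edges G) (λ e → Y (proj₁ e) (proj₂ e))
  Z : Fin n → Fin n → ℕ
  Z u v = Y u v when (toℕ u <ᵇ toℕ v) ∧ Adj G u v
  <ᵇ-false : ∀ m n → (m <ᵇ n) ≡ false → (n <ᵇ m) ≡ false → m ≡ n
  <ᵇ-false zero    zero    _ _ = refl
  <ᵇ-false (suc m) (suc n) h h′ = cong suc (<ᵇ-false m n h h′)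
  <ᵇ-asym : ∀ m n → (m <ᵇ n) ≡ true → (n <ᵇ m) ≡ true → 0 ≡ 1
  <ᵇ-asym (suc m) (suc n) h h′ = <ᵇ-asym m n h h′
  orient : ∀ u v → (Y u v when Adj G u v) ≡ Z u v * Z v u
  orient u v = go (toℕ u <ᵇ toℕ v) (toℕ v <ᵇ toℕ u) refl refl (Adj G u v) refl
    where
    go : ∀ s t → (toℕ u <ᵇ toℕ v) ≡ s → (toℕ v <ᵇ toℕ u) ≡ t → ∀ b → Adj G u v ≡ b → (Y u v when b) ≡ (Y u v when s ∧ b) * (Y v u when t ∧ Adj G v u)
    go true  true  es et b     eb with <ᵇ-asym (toℕ u) (toℕ v) es et
    ... | ()
    go true  false es et b     eb = sym (*-identityʳ _)
    go false true  es et b     eb rewrite trans (Graph.sym G v u) eb = trans (cong (_when b) (Y-comm u v)) (sym (+-identityʳ _))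
    go false false es et false eb = refl
    go false false es et true  eb with toℕ-injective (<ᵇ-false (toℕ u) (toℕ v) es et)
    ... | refl with trans (sym eb) (irrefl G u)
    ...   | ()

-- With k = P / w this says that the second component of `powProd` is ∏ c^(W/w), compared in the
-- power P so that no division occurs.
powProd-∏ : ∀ {A : Set} P (w c k : A → ℕ) → (∀ e → w e * k e ≡ P) → ∀ es →
            proj₂ (powProd (map (λ e → w e , c e) es)) ^ P ≡ ∏ es (λ e → c e ^ k e) ^ proj₁ (powProd (map (λ e → w e , c e) es))
powProd-∏ P w c k h []       = ^-zeroˡ P
powProd-∏ P w c k h (e ∷ es) with powProd (map (λ e → w e , c e) es) | powProd-∏ P w c k h es
... | W , R | ih = begin
  (c e ^ W * R ^ w e) ^ P
    ≡⟨ monomial-≡ (c e ∷ R ∷ []) (W ∷ w e ∷ P ∷ []) ((v0 ↑ x0 ⊗ v1 ↑ x1) ↑ x2) (v0 ↑ (x0 :* x2) ⊗ (v1 ↑ x2) ↑ x1) refl ⟩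
  c e ^ (W * P) * (R ^ P) ^ w e
    ≡⟨ cong₂ (λ p z → c e ^ (W * p) * z ^ w e) (sym (h e)) ih ⟩
  c e ^ (W * (w e * k e)) * (Q ^ W) ^ w e
    ≡⟨ monomial-≡ (c e ∷ Q ∷ []) (W ∷ w e ∷ k e ∷ []) (v0 ↑ (x0 :* (x1 :* x2)) ⊗ (v1 ↑ x0) ↑ x1) ((v0 ↑ x2 ⊗ v1) ↑ (x1 :* x0)) refl ⟩
  (c e ^ k e * Q) ^ (w e * W) ∎
  where
  open ≡-Reasoning
  Q = ∏ es (λ e → c e ^ k e)

theorem1p6 : (n : ℕ) (G : Graph n) (q : ℕ) → 1 ≤ q → (∀ v → 0 < deg G v) →
    colorings q G ^ proj₁ (powProd (edgeData q G)) ≤ proj₂ (powProd (edgeData q G))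
theorem1p6 n G q _ deg>0 = ^-cancelˡ-≤ (F * F) (*-mono-≤ F>0 F>0) (begin
  (colorings q G ^ W) ^ (F * F)           ≡⟨ monomial-≡ (colorings q G ∷ []) (W ∷ F * F ∷ []) ((v0 ↑ x0) ↑ x1) ((v0 ↑ x1) ↑ x0) refl ⟩
  (colorings q G ^ (F * F)) ^ W           ≤⟨ ^-monoˡ-≤ W (^-cancelˡ-≤ 2 (s≤s z≤n) main) ⟩
  ∏ (edges G) (λ e → colorings q (K (deg G (proj₁ e)) (deg G (proj₂ e))) ^ (r (deg G (proj₁ e)) * r (deg G (proj₂ e)))) ^ W
    ≡⟨ powProd-∏ (F * F) (λ e → deg G (proj₁ e) * deg G (proj₂ e)) (λ e → colorings q (K (deg G (proj₁ e)) (deg G (proj₂ e))))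
         (λ e → r (deg G (proj₁ e)) * r (deg G (proj₂ e))) inverse (edges G) ⟨
  proj₂ (powProd (edgeData q G)) ^ (F * F) ∎)
  where
  open ≤-Reasoning
  -- All degrees are at most n and positive, so each divides n!, and F² clears every d_u d_v.
  F = n !
  F>0 : 0 < F
  F>0 = 1≤n! n
  W = proj₁ (powProd (edgeData q G))
  r : ℕ → ℕ
  r zero    = 0
  r (suc d) = F / suc d
  r-inverse : ∀ {d} → 0 < d → d ≤ n → r d * d ≡ F
  r-inverse {suc d} _ d≤n = m/n*n≡m (∣-trans (m∣m*n (d !)) (m≤n⇒m!∣n! d≤n))
  open Step F {n} {q} r F>0 r-inverse
  r-deg : ∀ v → r (deg G v) * deg G v ≡ F
  r-deg v = r-inverse (deg>0 v) (≤-trans (≤-reflexive (deg-degree G v)) (degree≤n G v))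
  inverse : ∀ (e : Fin n × Fin n) → deg G (proj₁ e) * deg G (proj₂ e) * (r (deg G (proj₁ e)) * r (deg G (proj₂ e))) ≡ F * F
  inverse (u , v) = trans (eq (deg G u) (deg G v) (r (deg G u)) (r (deg G v))) (cong₂ _*_ (r-deg u) (r-deg v))
    where
    eq : ∀ a b x y → a * b * (x * y) ≡ x * a * (y * b)
    eq = solve-∀
  vertexBound-1 : ∀ v → vertexBound G full v ≡ 1
  vertexBound-1 v with degree G v | deg-degree G v | deg>0 v
  ... | zero  | e | pos = ⊥-elim (<⇒≱ pos (≤-reflexive e))
  ... | suc _ | _ | _   = refl
  edgeBound-≤ : ∀ (e : Fin n × Fin n) → edgeBound G full (proj₁ e) (proj₂ e) ≤
                colorings q (K (deg G (proj₁ e)) (deg G (proj₂ e))) ^ (r (deg G (proj₁ e)) * r (deg G (proj₂ e)))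
  edgeBound-≤ (u , v) rewrite deg-degree G u | deg-degree G v = ^-monoˡ-≤ (r (degree G u) * r (degree G v))
    (≤-trans (≤-reflexive (biclique-comm (degree G v) (degree G u) (λ _ → 1) (λ _ → 1))) (biclique-colorings (degree G u) (degree G v)))
  edgeBound-comm : ∀ u v → edgeBound G full u v ≡ edgeBound G full v u
  edgeBound-comm u v = cong₂ _^_ (biclique-comm (degree G v) (degree G u) (λ _ → 1) (λ _ → 1)) (*-comm (r (degree G u)) (r (degree G v)))
  main : (colorings q G ^ (F * F)) ^ 2 ≤
         ∏ (edges G) (λ e → colorings q (K (deg G (proj₁ e)) (deg G (proj₂ e))) ^ (r (deg G (proj₁ e)) * r (deg G (proj₂ e)))) ^ 2
  main = begin
    (colorings q G ^ (F * F)) ^ 2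
      ≡⟨ monomial-≡ (colorings q G ∷ []) (F * F ∷ []) ((v0 ↑ x0) ↑ con 2) (v0 ↑ (con 2 :* x0)) refl ⟩
    colorings q G ^ (2 * (F * F))
      ≡⟨ cong (_^ (2 * (F * F))) (colorings-partition q G) ⟩
    partition G full ^ (2 * (F * F))
      ≤⟨ partition-bound _ G full ≤-refl ⟩
    graphBound G full
      ≡⟨ trans (cong (_* ∏² (λ u v → edgeBound G full u v when Adj G u v)) (trans (∏-cong (allFin n) vertexBound-1) (∏-1 (allFin n)))) (+-identityʳ _) ⟩
    ∏² (λ u v → edgeBound G full u v when Adj G u v)
      ≡⟨ ∏²-edges G (edgeBound G full) edgeBound-comm ⟩
    ∏ (edges G) (λ e → edgeBound G full (proj₁ e) (proj₂ e)) ^ 2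
      ≤⟨ ^-monoˡ-≤ 2 (∏-mono (edges G) edgeBound-≤) ⟩
    ∏ (edges G) (λ e → colorings q (K (deg G (proj₁ e)) (deg G (proj₂ e))) ^ (r (deg G (proj₁ e)) * r (deg G (proj₂ e)))) ^ 2 ∎
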